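{- For every integer $n\geq 3$, the saltire graph ${SA}_{n,n}$ is claw-contractible-free and its chromatic symmetric function $X_{{SA}_{n,n}}$ is not $e$-positive.
   Context: All graphs are finite and simple. For a graph $G$ with vertex set $V=\{v_1,\dots,v_N\}$, the chromatic symmetric function is $X_G=\sum_\kappa x_{\kappa(v_1)}\cdots x_{\kappa(v_N)}$, summed over all proper colourings $\kappa:V\to\{1,2,\dots\}$ (adjacent vertices receive different colours). The elementary symmetric functions are $e_i=\sum_{j_1<\cdots<j_i}x_{j_1}\cdots x_{j_i}$ and $e_\lambda=e_{\lambda_1}\cdots e_{\lambda_\ell}$ for a partition $\lambda$; they form a basis of the algebra of symmetric functions. A symmetric function is $e$-positive if it is a non-negative linear combination of the $e_\lambda$. The claw is $K_{1,3}$. A graph $G$ contracts to the claw if there is a subset $S$ of its edges such that contracting all edges of $S$ (identifying endpoints) and replacing multiple edges by single edges yields the claw; $G$ is claw-contractible-free if it does not contract to the claw. For $a,b\geq 2$, the saltire graph ${SA}_{a,b}$ is the graph on vertices $v_1,\dots,v_{a+b}$ with edges $v_iv_{i+1}$ for $1\leq i\leq a+b-1$, together with $v_{a+b}v_1$, $v_1v_{a+1}$ and $v_2v_{a+2}$. -}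

module Defs where

open import Data.Nat using (ℕ; zero; suc; _+_; _∸_; _≡ᵇ_; _≥_) renaming (_≤_ to _≤ℕ_)
open import Data.Bool using (Bool; true; false; _∧_; _∨_; not; _xor_)
open import Data.Fin using (Fin; toℕ)
open import Data.Vec using (Vec; []; _∷_; lookup)
open import Data.List.Base using (List; []; _∷_; map; concatMap; length; filterᵇ; foldr; allFin)
open import Data.Bool.ListAction using (and)
open import Data.Nat.ListAction using (sum)
open import Data.List.Relation.Unary.All using (All)
open import Data.List.Relation.Unary.Linked using (Linked)
open import Data.Integer using (+_)
open import Data.Rational using (ℚ; 0ℚ; _/_; _≤_) renaming (_+_ to _+ℚ_; _*_ to _*ℚ_)
open import Data.Product using (Σ; ∃; _×_; _,_)
open import Data.Sum using (_⊎_)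
open import Relation.Binary.PropositionalEquality using (_≡_; _≢_)
open import Relation.Nullary using (¬_)

-- Finite simple graphs on vertex set Fin N, given by a Boolean
-- adjacency relation (edge {u,v} present iff G u v ≡ true or G v u ≡ true;
-- all graphs used below are symmetric and loop-free).

Graph : ℕ → Set
Graph N = Fin N → Fin N → Bool

finEq : {m : ℕ} → Fin m → Fin m → Bool
finEq a b = toℕ a ≡ᵇ toℕ b

vecs : {A : Set} → List A → (n : ℕ) → List (Vec A n)
vecs xs zero    = [] ∷ []
vecs xs (suc n) = concatMap (λ x → map (x ∷_) (vecs xs n)) xs

allᵇ : {A : Set} → (A → Bool) → List A → Bool
allᵇ p xs = and (map p xs)

ℕtoℚ : ℕ → ℚ
ℕtoℚ n = (+ n) / 1

sumℚ : List ℚ → ℚ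
sumℚ = foldr _+ℚ_ 0ℚ

-- Chromatic symmetric function, via its monomial coefficients.
-- Every monomial involves finitely many variables; the monomial
-- x_1^{α_1} ... x_k^{α_k} (all other exponents 0) is given by α : Vec ℕ k.
-- Its coefficient in X_G is the number of proper colourings
-- κ : V → {1..k} with |κ⁻¹(j)| = α_j for all j.

properᵇ : {N k : ℕ} → Graph N → Vec (Fin k) N → Bool
properᵇ {N} G κ =
  allᵇ (λ u → allᵇ (λ v → not (G u v) ∨ not (finEq (lookup κ u) (lookup κ v))) (allFin N)) (allFin N)

classSize : {N k : ℕ} → Vec (Fin k) N → Fin k → ℕ
classSize {N} κ j = length (filterᵇ (λ u → finEq (lookup κ u) j) (allFin N))

hasTypeᵇ : {N k : ℕ} → Vec ℕ k → Vec (Fin k) N → Bool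
hasTypeᵇ {N} {k} α κ = allᵇ (λ j → classSize κ j ≡ᵇ lookup α j) (allFin k)

coeffX : {N k : ℕ} → Graph N → Vec ℕ k → ℕ
coeffX {N} {k} G α =
  length (filterᵇ (λ κ → properᵇ G κ ∧ hasTypeᵇ α κ) (vecs (allFin k) N))

-- Elementary symmetric functions e_λ = e_{λ1} ⋯ e_{λℓ}, via monomial
-- coefficients: e_p = Σ_{|S| = p} ∏_{j∈S} x_j, so the coefficient of
-- x^α in e_λ (variables x_1..x_k) is the number of tuples (S_1,…,S_ℓ)
-- of subsets of {1..k} with |S_i| = λ_i and #{i : j ∈ S_i} = α_j.

subsetSize : {k : ℕ} → Vec Bool k → ℕ
subsetSize {k} S = length (filterᵇ (λ j → lookup S j) (allFin k))

subsetsOfSize : (k p : ℕ) → List (Vec Bool k)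
subsetsOfSize k p = filterᵇ (λ S → subsetSize S ≡ᵇ p) (vecs (true ∷ false ∷ []) k)

eTuples : (k : ℕ) → List ℕ → List (List (Vec Bool k))
eTuples k []       = [] ∷ []
eTuples k (p ∷ λ') = concatMap (λ S → map (S ∷_) (eTuples k λ')) (subsetsOfSize k p)

multiplicity : {k : ℕ} → Fin k → List (Vec Bool k) → ℕ
multiplicity j t = length (filterᵇ (λ S → lookup S j) t)

coeffE : {k : ℕ} → List ℕ → Vec ℕ k → ℕ
coeffE {k} λs α =
  length (filterᵇ (λ t → allᵇ (λ j → multiplicity j t ≡ᵇ lookup α j) (allFin k)) (eTuples k λs))

IsPartition : ℕ → List ℕ → Set
IsPartition N λs = (sum λs ≡ N) × All (1 ≤ℕ_) λs × Linked _≥_ λs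

EPositive : {N : ℕ} → Graph N → Set
EPositive {N} G =
  Σ (List (ℚ × List ℕ)) λ terms →
    All (λ { (q , λs) → (0ℚ ≤ q) × IsPartition N λs }) terms ×
    ((k : ℕ) (α : Vec ℕ k) →
      ℕtoℚ (coeffX G α) ≡ sumℚ (map (λ { (q , λs) → q *ℚ ℕtoℚ (coeffE λs α) }) terms))

-- Contraction to the claw.
-- Contracting an edge set S ⊆ E(G) gives the graph whose vertices are the
-- connected components of (V, S), two distinct components being adjacent
-- iff some edge of G joins them.  "G/S is the claw" is witnessed by a map
-- f : V → Fin 4 (quotient map composed with an isomorphism onto the claw):
-- f is surjective, its fibres are exactly the S-components, and distinct
-- a, b are claw-adjacent iff some G-edge joins f⁻¹(a) and f⁻¹(b).

data Reach {N : ℕ} (S : Graph N) : Fin N → Fin N → Set where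
  here : ∀ {u} → Reach S u u
  step : ∀ {u v w} → (S u v ≡ true ⊎ S v u ≡ true) → Reach S v w → Reach S u w

clawAdj : Fin 4 → Fin 4 → Bool
clawAdj a b = (toℕ a ≡ᵇ 0) xor (toℕ b ≡ᵇ 0)

ContractsToClaw : {N : ℕ} → Graph N → Set
ContractsToClaw {N} G =
  Σ (Graph N) λ S →
    (∀ u v → S u v ≡ true → G u v ≡ true) ×
    Σ (Fin N → Fin 4) λ f →
      (∀ c → ∃ λ u → f u ≡ c) ×
      (∀ u v → (f u ≡ f v → Reach S u v) × (Reach S u v → f u ≡ f v)) ×
      (∀ a b → a ≢ b →
        (clawAdj a b ≡ true → ∃ λ u → ∃ λ v → G u v ≡ true × f u ≡ a × f v ≡ b) ×
        ((∃ λ u → ∃ λ v → G u v ≡ true × f u ≡ a × f v ≡ b) → clawAdj a b ≡ true))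

ClawContractibleFree : {N : ℕ} → Graph N → Set
ClawContractibleFree G = ¬ ContractsToClaw G

-- Saltire graph SA_{a,b}: vertex v_{i+1} is represented by i : Fin (a + b).
-- Edges v_i v_{i+1} (1 ≤ i < a+b), v_{a+b} v_1, v_1 v_{a+1}, v_2 v_{a+2}.

saltireEdge : (a b : ℕ) → ℕ → ℕ → Bool
saltireEdge a b i j =
  (j ≡ᵇ suc i) ∨ ((i ≡ᵇ 0) ∧ (j ≡ᵇ (a + b) ∸ 1)) ∨
  ((i ≡ᵇ 0) ∧ (j ≡ᵇ a)) ∨ ((i ≡ᵇ 1) ∧ (j ≡ᵇ suc a))

saltire : (a b : ℕ) → Graph (a + b)
saltire a b u v = saltireEdge a b (toℕ u) (toℕ v) ∨ saltireEdge a b (toℕ v) (toℕ u)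

module Submission where

-- Claw-contractibility: representatives x < y < z of the three leaves cut the Hamiltonian cycle into three arcs, each
-- of which meets the centre C, because different leaves are not adjacent. Within C only the two chords can join
-- different arcs. If both chords lie in C, then they join the same pair of arcs, because v₁, v₂ and v_{n+1}, v_{n+2}
-- are consecutive. So at most one pair of arcs is joined and C is not connected.
--
-- e-positivity: evaluate at the n-th roots of unity. Then e_i = 0 for 0 < i < n and for i > n, and e_n² = 1, so on
-- degree 2n the evaluation is the coefficient of e_{nn}. SA_{n,n} consists of two paths on n vertices and all four
-- edges between the ends of the one and the ends of the other. For a path on n vertices with end colours i, j the sum
-- over proper colourings is ± ((n − 1) δ_ij − 1); summing over the admissible end colours gives −n(n−1)(n−2).
-- Instead of ℂ, the powers of a primitive root ζ are replaced by the values of a function τ : ℕ → ℤ that satisfies the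
-- linear relations between them.

-- In place of ζ there is a linear functional ℓ on ℚ(ζ), known only through τ(m) = ℓ(ζᵐ). The
-- normalisation τ(0) = 1 lets ℓ return rational values unchanged, and the values of e_{nn} and of X
-- are rational, so any such ℓ serves. Since ℓ is not multiplicative, products of evaluated
-- expressions are never formed: exponents are added inside the argument of τ, and a factor already
-- treated survives as a translation of τ. Nor can one divide by 1 - ζᵖ; instead a relation is
-- summed over all n rotations and the integer n is cancelled. Symmetric functions are given by
-- monomial coefficients, so evaluating at x_j = ζʲ becomes a finite integer combination of these
-- coefficients.

open import Defs
open import Algebra using (CommutativeSemiring; CommutativeRing)
open import Data.Bool using (Bool; true; false; _∧_; _∨_; not; T; if_then_else_)
open import Data.Bool.ListAction using (and)
import Data.Bool.Properties as Boolₚ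
open import Data.Empty using (⊥)
open import Data.Fin as Fin using (Fin; zero; suc; toℕ; fromℕ; fromℕ<; _↑ʳ_)
import Data.Fin.Properties as Finₚ
open import Data.Integer as ℤ using (ℤ; +_; 0ℤ; 1ℤ)
import Data.Integer.Properties as ℤₚ
open import Data.Integer.Tactic.RingSolver using () renaming (solve-∀ to solveℤ)
open import Data.List using (List; []; _∷_; _++_; allFin; concatMap; filterᵇ; length; map)
import Data.List.Properties as Listₚ
open import Data.List.Relation.Unary.All as All using (All; []; _∷_)
import Data.List.Relation.Unary.All.Properties as Allₚ
open import Data.Nat as ℕ using (ℕ; zero; suc; _≡ᵇ_; z≤n; s≤s; _≤_; _<_; _≤?_; _∸_; _!; NonZero)
import Data.Nat.Properties as ℕₚ
open import Data.Nat.Divisibility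
  using (_∣_; divides; _∣?_; ∣-trans; ∣-refl; ∣⇒≤; >⇒∤; _∣0; ∣m+n∣m⇒∣n; ∣m∣n⇒∣m+n; ∣m⇒∣m*n; m∣m*n; n∣m*n; *-monoʳ-∣; *-cancelˡ-∣)
open import Data.Nat.DivMod using (_%_; [m+kn]%n≡m%n; m<n⇒m%n≡m)
open import Data.Nat.GCD using (module GCD; module Bézout)
open import Data.Nat.ListAction using (sum)
open import Data.Nat.Primality using (Prime; prime?; euclidsLemma; ¬prime[0]; ¬prime[1])
open import Data.Nat.Primality.Factorisation using (factorise)
open import Data.Nat.Tactic.RingSolver using (solve-∀)
open import Data.Product using (∃; ∃-syntax; _×_; _,_; proj₁; proj₂)
open import Data.Rational as ℚ using (ℚ; 0ℚ)
import Data.Rational.Properties as ℚₚ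
import Data.Rational.Unnormalised as ℚᵘ
import Data.Rational.Unnormalised.Properties as ℚᵘₚ
open import Data.Sum using (_⊎_; inj₁; inj₂; [_,_]′)
open import Data.Vec as Vec using (Vec; []; _∷_; lookup)
import Data.Vec.Properties as Vecₚ
open import Data.Vec.Relation.Unary.Linked using (Linked; [-]; _∷_; [])
open import Function using (_∘_; id; mk⇔)
open import Level using (0ℓ)
open import Relation.Binary.Definitions using (tri<; tri≈; tri>)
open import Relation.Binary.PropositionalEquality
  using (_≡_; _≢_; refl; sym; trans; cong; cong₂; subst; module ≡-Reasoning)
open import Relation.Nullary using (¬_; yes; no; does; contradiction)
open import Relation.Nullary.Decidable using (dec-true; dec-false; does-⇔)

-- Finite sums over lists and indicator values of Booleans

module Summation (R : CommutativeSemiring 0ℓ 0ℓ) where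
  open CommutativeSemiring R hiding (zero)
    renaming (refl to ≈-refl; sym to ≈-sym; trans to ≈-trans; reflexive to ≈-reflexive)
  open import Relation.Binary.Reasoning.Setoid setoid
  open import Algebra.Properties.CommutativeSemigroup +-commutativeSemigroup using (interchange)

  ∑ : {A : Set} → List A → (A → Carrier) → Carrier
  ∑ []       f = 0#
  ∑ (x ∷ xs) f = f x + ∑ xs f

  ⟦_⟧ : Bool → Carrier
  ⟦ true ⟧  = 1#
  ⟦ false ⟧ = 0#

  ⟦⟧-∧ : ∀ a b → ⟦ a ∧ b ⟧ ≈ ⟦ a ⟧ * ⟦ b ⟧
  ⟦⟧-∧ true  b = ≈-sym (*-identityˡ _)
  ⟦⟧-∧ false b = ≈-sym (zeroˡ _)

  private variable A B : Set

  ∑-cong : (xs : List A) {f g : A → Carrier} → (∀ x → f x ≈ g x) → ∑ xs f ≈ ∑ xs g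
  ∑-cong []       e = ≈-refl
  ∑-cong (x ∷ xs) e = +-cong (e x) (∑-cong xs e)

  ∑-0 : (xs : List A) → ∑ xs (λ _ → 0#) ≈ 0#
  ∑-0 []       = ≈-refl
  ∑-0 (x ∷ xs) = ≈-trans (+-identityˡ _) (∑-0 xs)

  ∑-zero : (xs : List A) {f : A → Carrier} → (∀ x → f x ≈ 0#) → ∑ xs f ≈ 0#
  ∑-zero xs e = ≈-trans (∑-cong xs e) (∑-0 xs)

  ∑-+ : (xs : List A) (f g : A → Carrier) → ∑ xs (λ x → f x + g x) ≈ ∑ xs f + ∑ xs g
  ∑-+ []       f g = ≈-sym (+-identityˡ _)
  ∑-+ (x ∷ xs) f g = ≈-trans (+-congˡ (∑-+ xs f g)) (interchange _ _ _ _)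

  ∑-*ˡ : (xs : List A) (c : Carrier) (f : A → Carrier) → ∑ xs (λ x → c * f x) ≈ c * ∑ xs f
  ∑-*ˡ []       c f = ≈-sym (zeroʳ c)
  ∑-*ˡ (x ∷ xs) c f = ≈-trans (+-congˡ (∑-*ˡ xs c f)) (≈-sym (distribˡ c _ _))

  ∑-swap : (xs : List A) (ys : List B) (f : A → B → Carrier) →
           ∑ xs (λ x → ∑ ys (f x)) ≈ ∑ ys (λ y → ∑ xs (λ x → f x y))
  ∑-swap []       ys f = ≈-sym (∑-0 ys)
  ∑-swap (x ∷ xs) ys f = ≈-trans (+-congˡ (∑-swap xs ys f)) (≈-sym (∑-+ ys (f x) _))

  ∑-++ : (xs ys : List A) (f : A → Carrier) → ∑ (xs ++ ys) f ≈ ∑ xs f + ∑ ys f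
  ∑-++ []       ys f = ≈-sym (+-identityˡ _)
  ∑-++ (x ∷ xs) ys f = ≈-trans (+-congˡ (∑-++ xs ys f)) (≈-sym (+-assoc _ _ _))

  ∑-map : (h : A → B) (xs : List A) (f : B → Carrier) → ∑ (map h xs) f ≈ ∑ xs (f ∘ h)
  ∑-map h []       f = ≈-refl
  ∑-map h (x ∷ xs) f = +-congˡ (∑-map h xs f)

  ∑-concatMap : (h : A → List B) (xs : List A) (f : B → Carrier) →
                ∑ (concatMap h xs) f ≈ ∑ xs (λ x → ∑ (h x) f)
  ∑-concatMap h []       f = ≈-refl
  ∑-concatMap h (x ∷ xs) f = ≈-trans (∑-++ (h x) _ f) (+-congˡ (∑-concatMap h xs f))

  ∑-filter : (p : A → Bool) (xs : List A) (f : A → Carrier) →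
             ∑ (filterᵇ p xs) f ≈ ∑ xs (λ x → ⟦ p x ⟧ * f x)
  ∑-filter p []       f = ≈-refl
  ∑-filter p (x ∷ xs) f with p x
  ... | true  = +-cong (≈-sym (*-identityˡ _)) (∑-filter p xs f)
  ... | false = ≈-trans (∑-filter p xs f) (≈-sym (≈-trans (+-congʳ (zeroˡ _)) (+-identityˡ _)))

  ∑-allFin : ∀ n (f : Fin (suc n) → Carrier) →
             ∑ (allFin (suc n)) f ≈ f zero + ∑ (allFin n) (f ∘ suc)
  ∑-allFin n f = +-congˡ (≈-trans (≈-reflexive (cong (λ xs → ∑ xs f) (sym (Listₚ.map-tabulate id suc))))
                                  (∑-map suc (allFin n) f))

  ∑-vecs : (xs : List A) (m : ℕ) (f : Vec A (suc m) → Carrier) →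
           ∑ (vecs xs (suc m)) f ≈ ∑ xs (λ x → ∑ (vecs xs m) (λ v → f (x ∷ v)))
  ∑-vecs xs m f = ≈-trans (∑-concatMap _ xs f) (∑-cong xs (λ x → ∑-map (x ∷_) (vecs xs m) f))

  ∑-vecs-++ : (xs : List A) (m k : ℕ) (f : Vec A (m ℕ.+ k) → Carrier) →
              ∑ (vecs xs (m ℕ.+ k)) f ≈ ∑ (vecs xs m) (λ v → ∑ (vecs xs k) (λ w → f (v Vec.++ w)))
  ∑-vecs-++ xs zero    k f = ≈-sym (+-identityʳ _)
  ∑-vecs-++ xs (suc m) k f = begin
    ∑ (vecs xs (suc m ℕ.+ k)) f                                 ≈⟨ ∑-vecs xs (m ℕ.+ k) f ⟩
    ∑ xs (λ x → ∑ (vecs xs (m ℕ.+ k)) (λ v → f (x ∷ v)))        ≈⟨ ∑-cong xs (λ x → ∑-vecs-++ xs m k _) ⟩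
    ∑ xs (λ x → ∑ (vecs xs m) (λ v → ∑ (vecs xs k) (λ w → f (x ∷ v Vec.++ w)))) ≈⟨ ∑-vecs xs m _ ⟨
    ∑ (vecs xs (suc m)) (λ v → ∑ (vecs xs k) (λ w → f (v Vec.++ w)))            ∎

open import Data.Integer using (_+_; _*_; -_; _-_)
open ≡-Reasoning

module Sumℕ = Summation ℕₚ.+-*-commutativeSemiring
module Sumℚ = Summation (CommutativeRing.commutativeSemiring ℚₚ.+-*-commutativeRing)
open Summation ℤₚ.+-*-commutativeSemiring public

∑-pos : {A : Set} (xs : List A) (f : A → ℕ) → + Sumℕ.∑ xs f ≡ ∑ xs (λ x → + f x)
∑-pos []       f = refl
∑-pos (x ∷ xs) f = trans (ℤₚ.pos-+ (f x) _) (cong (_+_ (+ f x)) (∑-pos xs f))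

length-filterᵇ : {A : Set} (p : A → Bool) (xs : List A) → length (filterᵇ p xs) ≡ Sumℕ.∑ xs (λ x → Sumℕ.⟦ p x ⟧)
length-filterᵇ p []       = refl
length-filterᵇ p (x ∷ xs) with p x
... | true  = cong suc (length-filterᵇ p xs)
... | false = length-filterᵇ p xs

pos-⟦⟧ : ∀ b → + Sumℕ.⟦ b ⟧ ≡ ⟦ b ⟧
pos-⟦⟧ true  = refl
pos-⟦⟧ false = refl

+length-filterᵇ : {A : Set} (p : A → Bool) (xs : List A) → + length (filterᵇ p xs) ≡ ∑ xs (λ x → ⟦ p x ⟧)
+length-filterᵇ p xs = trans (cong +_ (length-filterᵇ p xs))
  (trans (∑-pos xs _) (∑-cong xs (λ x → pos-⟦⟧ (p x))))

∑-const : ∀ n (c : ℤ) → ∑ (allFin n) (λ _ → c) ≡ + n * c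
∑-const zero    c = refl
∑-const (suc n) c = trans (∑-allFin n (λ _ → c)) (trans (cong (_+_ c) (∑-const n c)) (sym (ℤₚ.suc-* (+ n) c)))

∑-neg : {A : Set} (xs : List A) (f : A → ℤ) → ∑ xs (λ x → - f x) ≡ - ∑ xs f
∑-neg []       f = refl
∑-neg (x ∷ xs) f = trans (cong (_+_ (- f x)) (∑-neg xs f)) (sym (ℤₚ.neg-distrib-+ (f x) _))

∑-- : {A : Set} (xs : List A) (f g : A → ℤ) → ∑ xs (λ x → f x - g x) ≡ ∑ xs f - ∑ xs g
∑-- xs f g = trans (∑-+ xs f _) (cong (_+_ (∑ xs f)) (∑-neg xs g))

allᵇ-allFin : ∀ n (p : Fin (suc n) → Bool) → allᵇ p (allFin (suc n)) ≡ p zero ∧ allᵇ (p ∘ suc) (allFin n)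
allᵇ-allFin n p = cong (p zero ∧_) (cong and (trans (Listₚ.map-tabulate suc p) (sym (Listₚ.map-tabulate id (p ∘ suc)))))

-- Claw contractions

∨-true : ∀ {a b} → a ∨ b ≡ true → a ≡ true ⊎ b ≡ true
∨-true {true}  e = inj₁ refl
∨-true {false} e = inj₂ e

∧-true : ∀ {a b} → a ∧ b ≡ true → a ≡ true × b ≡ true
∧-true {true} {true} e = refl , refl

≡ᵇ-sound : ∀ m n → (m ≡ᵇ n) ≡ true → m ≡ n
≡ᵇ-sound m n e = ℕₚ.≡ᵇ⇒≡ m n (subst T (sym e) _)

≡ᵇ-complete : ∀ {m n} → m ≡ n → (m ≡ᵇ n) ≡ true
≡ᵇ-complete {zero}  refl = refl
≡ᵇ-complete {suc m} refl = ≡ᵇ-complete {m} refl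

data SaltireEdge (n i j : ℕ) : Set where
  path   : j ≡ suc i → SaltireEdge n i j
  close  : i ≡ 0 → j ≡ (n ℕ.+ n) ∸ 1 → SaltireEdge n i j
  chord₀ : i ≡ 0 → j ≡ n → SaltireEdge n i j
  chord₁ : i ≡ 1 → j ≡ suc n → SaltireEdge n i j

saltireEdge-sound : ∀ n i j → saltireEdge n n i j ≡ true → SaltireEdge n i j
saltireEdge-sound n i j e with ∨-true e
... | inj₁ p = path (≡ᵇ-sound j (suc i) p)
... | inj₂ e′ with ∨-true {(i ≡ᵇ 0) ∧ (j ≡ᵇ (n ℕ.+ n) ∸ 1)} e′
... | inj₁ p with p₁ , p₂ ← ∧-true {i ≡ᵇ 0} p = close (≡ᵇ-sound i 0 p₁) (≡ᵇ-sound j _ p₂)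
... | inj₂ e″ with ∨-true {(i ≡ᵇ 0) ∧ (j ≡ᵇ n)} e″
... | inj₁ p with p₁ , p₂ ← ∧-true {i ≡ᵇ 0} p = chord₀ (≡ᵇ-sound i 0 p₁) (≡ᵇ-sound j n p₂)
... | inj₂ p with p₁ , p₂ ← ∧-true {i ≡ᵇ 1} p = chord₁ (≡ᵇ-sound i 1 p₁) (≡ᵇ-sound j (suc n) p₂)

saltireEdge-complete : ∀ {n i j} → SaltireEdge n i j → saltireEdge n n i j ≡ true
saltireEdge-complete {n} {i} (path refl) rewrite ≡ᵇ-complete {i} refl = refl
saltireEdge-complete {n} {j = j} (close refl q) rewrite ≡ᵇ-complete q = Boolₚ.∨-zeroʳ (j ≡ᵇ 1)
saltireEdge-complete {n} {j = j} (chord₀ refl q) rewrite ≡ᵇ-complete q =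
  trans (cong ((j ≡ᵇ 1) ∨_) (Boolₚ.∨-zeroʳ (j ≡ᵇ (n ℕ.+ n) ∸ 1))) (Boolₚ.∨-zeroʳ (j ≡ᵇ 1))
saltireEdge-complete {n} {j = j} (chord₁ refl q) rewrite ≡ᵇ-complete q = Boolₚ.∨-zeroʳ (j ≡ᵇ 2)

saltire-sound : ∀ n (u v : Fin (n ℕ.+ n)) → saltire n n u v ≡ true →
                SaltireEdge n (toℕ u) (toℕ v) ⊎ SaltireEdge n (toℕ v) (toℕ u)
saltire-sound n u v e with ∨-true e
... | inj₁ p = inj₁ (saltireEdge-sound n _ _ p)
... | inj₂ p = inj₂ (saltireEdge-sound n _ _ p)

saltire-complete : ∀ n (u v : Fin (n ℕ.+ n)) → SaltireEdge n (toℕ u) (toℕ v) → saltire n n u v ≡ true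
saltire-complete n u v e rewrite saltireEdge-complete e = refl

saltire-sym : ∀ n (u v : Fin (n ℕ.+ n)) → saltire n n u v ≡ saltire n n v u
saltire-sym n u v = Boolₚ.∨-comm (saltireEdge n n (toℕ u) (toℕ v)) _

clawAdj-leaves : ∀ {a b} → a ≢ zero → b ≢ zero → clawAdj a b ≡ false
clawAdj-leaves {zero}          p q = contradiction refl p
clawAdj-leaves {suc a} {zero}  p q = contradiction refl q
clawAdj-leaves {suc a} {suc b} p q = refl

avoid : (a b : Fin 3) → ∃[ t ] a ≢ t × b ≢ t
avoid zero          zero          = suc zero , (λ ()) , (λ ())
avoid zero          (suc zero)    = suc (suc zero) , (λ ()) , (λ ())
avoid zero          (suc (suc _)) = suc zero , (λ ()) , (λ ())
avoid (suc zero)    zero          = suc (suc zero) , (λ ()) , (λ ())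
avoid (suc (suc _)) zero          = suc zero , (λ ()) , (λ ())
avoid (suc _)       (suc _)       = zero , (λ ()) , (λ ())

≤?-suc : ∀ {i x} → i ≢ x → does (suc i ≤? x) ≡ does (i ≤? x)
≤?-suc {i} {x} i≢x with i ≤? x
... | yes i≤x = trans (dec-true (suc i ≤? x) (ℕₚ.≤∧≢⇒< i≤x i≢x)) (sym (dec-true (i ≤? x) i≤x))
... | no  i≰x = trans (dec-false (suc i ≤? x) (i≰x ∘ ℕₚ.<⇒≤)) (sym (dec-false (i ≤? x) i≰x))

-- The three arcs into which x < y < z cut the cycle: ]z, x], ]x, y] and ]y, z].
arc : (x y z i : ℕ) → Fin 3
arc x y z i =
  if does (i ≤? x) then zero else if does (i ≤? y) then suc zero else if does (i ≤? z) then suc (suc zero) else zero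

arc-suc : ∀ {x y z i} → i ≢ x → i ≢ y → i ≢ z → arc x y z (suc i) ≡ arc x y z i
arc-suc p q r rewrite ≤?-suc p | ≤?-suc q | ≤?-suc r = refl

arc-≤x : ∀ {x y z i} → i ≤ x → arc x y z i ≡ zero
arc-≤x {x} {i = i} p rewrite dec-true (i ≤? x) p = refl

arc-≤y : ∀ {x y z i} → x < i → i ≤ y → arc x y z i ≡ suc zero
arc-≤y {x} {y} {i = i} p q rewrite dec-false (i ≤? x) (ℕₚ.<⇒≱ p) | dec-true (i ≤? y) q = refl

arc-≤z : ∀ {x y z i} → x < y → y < i → i ≤ z → arc x y z i ≡ suc (suc zero)
arc-≤z {x} {y} {z} {i = i} o p q
  rewrite dec-false (i ≤? x) (ℕₚ.<⇒≱ (ℕₚ.<-trans o p)) | dec-false (i ≤? y) (ℕₚ.<⇒≱ p) | dec-true (i ≤? z) q = refl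

arc->z : ∀ {x y z i} → x < y → y < z → z < i → arc x y z i ≡ zero
arc->z {x} {y} {z} {i = i} o p q
  rewrite dec-false (i ≤? x) (ℕₚ.<⇒≱ (ℕₚ.<-trans o (ℕₚ.<-trans p q)))
        | dec-false (i ≤? y) (ℕₚ.<⇒≱ (ℕₚ.<-trans p q)) | dec-false (i ≤? z) (ℕₚ.<⇒≱ q) = refl

module ClawMinor (n : ℕ) (2≤n : 2 ≤ n) (S : Graph (n ℕ.+ n)) (f : Fin (n ℕ.+ n) → Fin 4)
  (S⊆G : ∀ u v → S u v ≡ true → saltire n n u v ≡ true)
  (connected : ∀ u v → f u ≡ f v → Reach S u v)
  (fibre : ∀ u v → Reach S u v → f u ≡ f v)
  (adjacent : ∀ u v → saltire n n u v ≡ true → f u ≢ f v → clawAdj (f u) (f v) ≡ true)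
  where

  V : Set
  V = Fin (n ℕ.+ n)

  -- Distinct leaves of the claw are not adjacent, so an edge that misses the centre (label `zero`)
  -- stays inside one fibre.
  leaf-edge : ∀ u v → saltire n n u v ≡ true → f u ≢ zero → f v ≢ zero → f v ≡ f u
  leaf-edge u v e p q with f u Finₚ.≟ f v
  ... | yes r = sym r
  ... | no  r = contradiction (trans (sym (adjacent u v e r)) (clawAdj-leaves p q)) λ ()

  -- Walking upwards from `u` to `v` through consecutive vertices, the label can change only by
  -- entering the centre; induction on the distance `d`.
  centre-between : ∀ d (u v : V) → toℕ v ≡ d ℕ.+ toℕ u → f u ≢ zero →
                   f v ≡ f u ⊎ ∃[ w ] toℕ u < toℕ w × toℕ w ≤ toℕ v × f w ≡ zero
  centre-between zero    u v e p = inj₁ (cong f (Finₚ.toℕ-injective e))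
  centre-between (suc d) u v e p with centre-between d u v′ v′≡ p
    where
    v′<N : d ℕ.+ toℕ u < n ℕ.+ n
    v′<N = ℕₚ.<-trans (ℕₚ.n<1+n _) (subst (_< n ℕ.+ n) e (Finₚ.toℕ<n v))
    v′ : V
    v′ = fromℕ< v′<N
    v′≡ : toℕ v′ ≡ d ℕ.+ toℕ u
    v′≡ = Finₚ.toℕ-fromℕ< v′<N
  ... | inj₂ (w , u<w , w≤v′ , c) = inj₂ (w , u<w , ℕₚ.≤-trans w≤v′ v′≤v , c)
    where
    v′≤v : _ ≤ toℕ v
    v′≤v = subst (_≤ toℕ v) (sym (Finₚ.toℕ-fromℕ< _)) (subst (d ℕ.+ toℕ u ≤_) (sym e) (ℕₚ.n≤1+n _))
  ... | inj₁ q with f v Finₚ.≟ zero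
  ... | yes c = inj₂ (v , subst (toℕ u <_) (sym e) (s≤s (ℕₚ.m≤n+m _ d)) , ℕₚ.≤-refl , c)
  ... | no  c = inj₁ (trans (leaf-edge _ v (saltire-complete n _ v (path (trans e (cong suc (sym (Finₚ.toℕ-fromℕ< _))))))
                                       (p ∘ trans (sym q)) c) q)

  centre-between-< : ∀ u v → toℕ u < toℕ v → f u ≢ zero → f u ≢ f v →
                     ∃[ w ] toℕ u < toℕ w × toℕ w ≤ toℕ v × f w ≡ zero
  centre-between-< u v u<v p q with centre-between (toℕ v ∸ toℕ u) u v (sym (ℕₚ.m∸n+n≡m (ℕₚ.<⇒≤ u<v))) p
  ... | inj₁ r = contradiction (sym r) q
  ... | inj₂ w = w

  0<N : 0 < n ℕ.+ n
  0<N = ℕₚ.≤-trans (s≤s z≤n) (ℕₚ.≤-trans 2≤n (ℕₚ.m≤m+n n n))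

  first last : V
  first = fromℕ< 0<N
  last  = fromℕ< (ℕₚ.∸-monoʳ-< {n ℕ.+ n} (s≤s z≤n) 0<N)

  toℕ-first : toℕ first ≡ 0
  toℕ-first = Finₚ.toℕ-fromℕ< _

  toℕ-last : toℕ last ≡ (n ℕ.+ n) ∸ 1
  toℕ-last = Finₚ.toℕ-fromℕ< _

  ≤last : ∀ (u : V) → toℕ u ≤ toℕ last
  ≤last u = subst (toℕ u ≤_) (sym toℕ-last) (ℕₚ.∸-monoˡ-≤ 1 (Finₚ.toℕ<n u))

  module ThreeLeaves (x y z : V) (x<y : toℕ x < toℕ y) (y<z : toℕ y < toℕ z)
    (x-leaf : f x ≢ zero) (y-leaf : f y ≢ zero) (z-leaf : f z ≢ zero)
    (x≢y : f x ≢ f y) (y≢z : f y ≢ f z) (z≢x : f z ≢ f x) where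

    arcOf : V → Fin 3
    arcOf u = arc (toℕ x) (toℕ y) (toℕ z) (toℕ u)

    centre-on-arc : ∀ t → ∃[ w ] f w ≡ zero × arcOf w ≡ t
    centre-on-arc (suc zero) with w , x<w , w≤y , c ← centre-between-< x y x<y x-leaf x≢y =
      w , c , arc-≤y x<w w≤y
    centre-on-arc (suc (suc zero)) with w , y<w , w≤z , c ← centre-between-< y z y<z y-leaf y≢z =
      w , c , arc-≤z x<y y<w w≤z
    -- This arc wraps around: from `z` up to `last`, over the closing edge to `first`, then up to
    -- `x`. If no stage met the centre, the label of `z` would be carried to `x`, against `z≢x`.
    centre-on-arc zero with centre-between (toℕ last ∸ toℕ z) z last (sym (ℕₚ.m∸n+n≡m (≤last z))) z-leaf
    ... | inj₂ (w , z<w , _ , c) = w , c , arc->z x<y y<z z<w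
    ... | inj₁ fl≡fz with f first Finₚ.≟ zero
    ... | yes c = first , c , arc-≤x (subst (_≤ toℕ x) (sym toℕ-first) z≤n)
    ... | no  c with centre-between (toℕ x) first x (sym (trans (cong (toℕ x ℕ.+_) toℕ-first) (ℕₚ.+-identityʳ _))) c
    ... | inj₂ (w , _ , w≤x , c′) = w , c′ , arc-≤x w≤x
    ... | inj₁ fx≡ff = contradiction (trans (sym fl≡fz) (trans fl≡ff (sym fx≡ff))) z≢x
      where
      fl≡ff : f last ≡ f first
      fl≡ff = leaf-edge first last (saltire-complete n first last (close toℕ-first toℕ-last)) c
                (z-leaf ∘ trans (sym fl≡fz))

    arcOf-cong : ∀ u v → toℕ u ≡ toℕ v → arcOf u ≡ arcOf v
    arcOf-cong u v e = cong arcOf (Finₚ.toℕ-injective e)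

    centre≢ : ∀ {u w} → f u ≡ zero → f w ≢ zero → toℕ u ≢ toℕ w
    centre≢ c l e = l (trans (cong f (sym (Finₚ.toℕ-injective e))) c)

    -- Arcs end only at `x`, `y` and `z`. These are leaves, so a centre vertex is never the end of
    -- its arc and its successor still belongs to that arc.
    arc-path : ∀ {u v} → f u ≡ zero → toℕ v ≡ suc (toℕ u) → arcOf v ≡ arcOf u
    arc-path c e = trans (cong (arc _ _ _) e) (arc-suc (centre≢ c x-leaf) (centre≢ c y-leaf) (centre≢ c z-leaf))

    -- The last vertex `v` is in the centre and so differs from the leaf `z`; hence it lies beyond
    -- `z`, on the arc that wraps around to index 0.
    arc-close : ∀ {u v} → toℕ u ≡ 0 → toℕ v ≡ (n ℕ.+ n) ∸ 1 → f v ≡ zero → arcOf v ≡ arcOf u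
    arc-close {u} {v} p q c = trans (arc->z x<y y<z z<v) (sym (arc-≤x (subst (_≤ toℕ x) (sym p) z≤n)))
      where
      z<v : toℕ z < toℕ v
      z<v = ℕₚ.≤∧≢⇒< (subst (toℕ z ≤_) (trans toℕ-last (sym q)) (≤last z)) (centre≢ c z-leaf ∘ sym)

    n<N : n < n ℕ.+ n
    n<N = ℕₚ.m<m+n n (ℕₚ.<⇒≤ 2≤n)

    -- Subscripts count from zero here: `first`, `v₁`, `vₙ`, `vₙ₊₁` are the vertices v₁, v₂,
    -- v_{n+1}, v_{n+2} of the graph.
    v₁ vₙ vₙ₊₁ : V
    v₁   = fromℕ< (ℕₚ.≤-trans 2≤n (ℕₚ.m≤m+n n n))
    vₙ   = fromℕ< n<N
    vₙ₊₁ = fromℕ< (ℕₚ.≤-trans (ℕₚ.≤-reflexive (ℕₚ.+-comm 2 n)) (ℕₚ.+-monoʳ-≤ n 2≤n))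

    -- For such a `t` no edge between two centre vertices joins arc `t` to another arc.
    AvoidsChords : Fin 3 → Set
    AvoidsChords t = ∀ u v → f u ≡ zero → f v ≡ zero →
      (toℕ u ≡ 0 × toℕ v ≡ n) ⊎ (toℕ u ≡ 1 × toℕ v ≡ suc n) → arcOf u ≢ t × arcOf v ≢ t

    -- When the chord from `first` to `vₙ` is not inside the centre, only the two ends of the other
    -- chord have to be avoided, and there are three arcs.
    chord₁-avoidable : ¬ (f first ≡ zero × f vₙ ≡ zero) → ∃ AvoidsChords
    chord₁-avoidable ¬c with t , p , q ← avoid (arcOf v₁) (arcOf vₙ₊₁) = t , λ where
      u v cu cv (inj₁ (eu , ev)) → contradiction
        ( trans (cong f (Finₚ.toℕ-injective (trans toℕ-first (sym eu)))) cu
        , trans (cong f (Finₚ.toℕ-injective (trans (Finₚ.toℕ-fromℕ< _) (sym ev)))) cv ) ¬c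
      u v cu cv (inj₂ (eu , ev)) → p ∘ trans (arcOf-cong v₁ u (trans (Finₚ.toℕ-fromℕ< _) (sym eu))) ,
                                   q ∘ trans (arcOf-cong vₙ₊₁ v (trans (Finₚ.toℕ-fromℕ< _) (sym ev)))

    avoidsChords : ∃ AvoidsChords
    avoidsChords with f first Finₚ.≟ zero | f vₙ Finₚ.≟ zero
    ... | no  ¬c | _     = chord₁-avoidable (¬c ∘ proj₁)
    ... | yes _  | no ¬c = chord₁-avoidable (¬c ∘ proj₂)
    ... | yes c₀ | yes cₙ with t , p , q ← avoid (arcOf first) (arcOf vₙ) = t , λ where
      u v cu cv (inj₁ (eu , ev)) → p ∘ trans (arcOf-cong first u (trans toℕ-first (sym eu))) ,
                                   q ∘ trans (arcOf-cong vₙ v (trans (Finₚ.toℕ-fromℕ< _) (sym ev)))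
      u v cu cv (inj₂ (eu , ev)) →
        p ∘ trans (sym (arc-path c₀ (trans eu (cong suc (sym toℕ-first))))) ,
        q ∘ trans (sym (arc-path cₙ (trans ev (cong suc (sym (Finₚ.toℕ-fromℕ< _))))))

    t₀ : Fin 3
    t₀ = proj₁ avoidsChords

    edge-in-arc : ∀ u v → SaltireEdge n (toℕ u) (toℕ v) → f u ≡ zero → f v ≡ zero →
                  (arcOf u ≡ t₀ → arcOf v ≡ t₀) × (arcOf v ≡ t₀ → arcOf u ≡ t₀)
    edge-in-arc u v (path e) cu cv = trans (arc-path cu e) , trans (sym (arc-path cu e))
    edge-in-arc u v (close p q) cu cv = trans (arc-close {u} p q cv) , trans (sym (arc-close {u} p q cv))
    edge-in-arc u v (chord₀ p q) cu cv with a , b ← proj₂ avoidsChords u v cu cv (inj₁ (p , q)) =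
      (λ e → contradiction e a) , (λ e → contradiction e b)
    edge-in-arc u v (chord₁ p q) cu cv with a , b ← proj₂ avoidsChords u v cu cv (inj₂ (p , q)) =
      (λ e → contradiction e a) , (λ e → contradiction e b)

    -- Steps in `S` do not leave a fibre, so the whole walk runs through centre vertices and
    -- `edge-in-arc` applies to each step.
    reach-in-arc : ∀ {u v} → Reach S u v → f u ≡ zero → arcOf u ≡ t₀ → arcOf v ≡ t₀
    reach-in-arc here cu e = e
    reach-in-arc {u} (step {v = v} s r) cu e = reach-in-arc r cv ([ forth , back ]′ (saltire-sound n u v (edge s)))
      where
      edge : S u v ≡ true ⊎ S v u ≡ true → saltire n n u v ≡ true
      edge (inj₁ s) = S⊆G u v s
      edge (inj₂ s) = trans (saltire-sym n u v) (S⊆G v u s)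
      cv : f v ≡ zero
      cv = trans (sym (fibre u v (step s here))) cu
      forth : SaltireEdge n (toℕ u) (toℕ v) → arcOf v ≡ t₀
      forth g = proj₁ (edge-in-arc u v g cu cv) e
      back : SaltireEdge n (toℕ v) (toℕ u) → arcOf v ≡ t₀
      back g = proj₂ (edge-in-arc v u g cv cu) e

    impossible : ⊥
    impossible with t , t₀≢t , _ ← avoid t₀ t₀
               with w , cw , aw ← centre-on-arc t₀ | w′ , cw′ , aw′ ← centre-on-arc t =
      t₀≢t (trans (sym (reach-in-arc (connected w w′ (trans cw (sym cw′))) cw aw)) aw′)

  -- The three inequalities are stated cyclically: an even rearrangement of `x`, `y`, `z` only
  -- rotates them, an odd one reverses each.
  no-three-leaves : ∀ x y z → f x ≢ zero → f y ≢ zero → f z ≢ zero →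
                    f x ≢ f y → f y ≢ f z → f z ≢ f x → ⊥
  no-three-leaves x y z lx ly lz x≢y y≢z z≢x
    with ℕₚ.<-cmp (toℕ x) (toℕ y) | ℕₚ.<-cmp (toℕ y) (toℕ z) | ℕₚ.<-cmp (toℕ z) (toℕ x)
  ... | tri≈ _ e _ | _ | _ = x≢y (cong f (Finₚ.toℕ-injective e))
  ... | _ | tri≈ _ e _ | _ = y≢z (cong f (Finₚ.toℕ-injective e))
  ... | _ | _ | tri≈ _ e _ = z≢x (cong f (Finₚ.toℕ-injective e))
  ... | tri< p _ _ | tri< q _ _ | _ = ThreeLeaves.impossible x y z p q lx ly lz x≢y y≢z z≢x
  ... | tri< p _ _ | tri> _ _ q | tri< r _ _ = ThreeLeaves.impossible z x y r p lz lx ly z≢x x≢y y≢z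
  ... | tri< p _ _ | tri> _ _ q | tri> _ _ r =
    ThreeLeaves.impossible x z y r q lx lz ly (z≢x ∘ sym) (y≢z ∘ sym) (x≢y ∘ sym)
  ... | tri> _ _ p | tri< q _ _ | tri< r _ _ = ThreeLeaves.impossible y z x q r ly lz lx y≢z z≢x x≢y
  ... | tri> _ _ p | tri< q _ _ | tri> _ _ r =
    ThreeLeaves.impossible y x z p r ly lx lz (x≢y ∘ sym) (z≢x ∘ sym) (y≢z ∘ sym)
  ... | tri> _ _ p | tri> _ _ q | _ =
    ThreeLeaves.impossible z y x q p lz ly lx (y≢z ∘ sym) (x≢y ∘ sym) (z≢x ∘ sym)

saltire-clawContractibleFree : ∀ n → 2 ≤ n → ClawContractibleFree (saltire n n)
saltire-clawContractibleFree n 2≤n (S , S⊆G , f , surj , fib , adj)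
  with x , fx ← surj (suc zero) | y , fy ← surj (suc (suc zero)) | z , fz ← surj (suc (suc (suc zero))) =
  ClawMinor.no-three-leaves n 2≤n S f S⊆G (λ u v → proj₁ (fib u v)) (λ u v → proj₂ (fib u v))
    (λ u v e d → proj₂ (adj (f u) (f v) d) (u , v , e , refl , refl))
    x y z (λ e → 0≢ (trans (sym fx) e)) (λ e → 0≢ (trans (sym fy) e)) (λ e → 0≢ (trans (sym fz) e))
    (λ e → 1≢2 (trans (sym fx) (trans e fy))) (λ e → 2≢3 (trans (sym fy) (trans e fz)))
    (λ e → 3≢1 (trans (sym fz) (trans e fx)))
  where
  0≢ : ∀ {i : Fin 3} → suc i ≢ zero
  0≢ ()
  1≢2 : Fin.suc {3} zero ≢ suc (suc zero)
  1≢2 ()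
  2≢3 : Fin.suc {3} (suc zero) ≢ suc (suc (suc zero))
  2≢3 ()
  3≢1 : Fin.suc {3} (suc (suc zero)) ≢ suc zero
  3≢1 ()

-- Values of linear functionals at powers of a root of unity

-- F behaves like m ↦ ℓ(ζᵐ) for a primitive n-th root of unity ζ and a linear functional ℓ on ℚ(ζ).
record Cyclotomic (n : ℕ) (F : ℕ → ℤ) : Set where
  field
    periodic : ∀ m → F (m ℕ.+ n) ≡ F m
    balanced : ∀ m k → ¬ n ∣ k → ∑ (allFin n) (λ j → F (m ℕ.+ toℕ j ℕ.* k)) ≡ 0ℤ

-- In terms of ℓ this is the functional z ↦ ℓ(ζᵃ z).
cyclotomic-translate : ∀ {n F} → Cyclotomic n F → ∀ a → Cyclotomic n (λ m → F (a ℕ.+ m))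
cyclotomic-translate {n} {F} cyc a = record
  { periodic = λ m → trans (cong F (sym (ℕₚ.+-assoc a m n))) (Cyclotomic.periodic cyc (a ℕ.+ m))
  ; balanced = λ m k d → trans (∑-cong (allFin n) (λ j → cong F (sym (ℕₚ.+-assoc a m (toℕ j ℕ.* k)))))
                               (Cyclotomic.balanced cyc (a ℕ.+ m) k d)
  }

+-swapʳ : ∀ a b c → a ℕ.+ b ℕ.+ c ≡ a ℕ.+ c ℕ.+ b
+-swapʳ = solve-∀

-- The identity (1 + g + ⋯ + g^{k-1})(1 - g) = 1 - g^k, where g is translation by `q`. It serves
-- twice: for a new factor of the sieve, and to find the period `k` of a sum with stride `k`.
∑-telescope : ∀ k q m (F : ℕ → ℤ) →
  ∑ (allFin k) (λ i → F (m ℕ.+ toℕ i ℕ.* q) - F (m ℕ.+ toℕ i ℕ.* q ℕ.+ q)) ≡ F m - F (m ℕ.+ k ℕ.* q)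
∑-telescope zero    q m F = sym (trans (cong (λ x → F m - F x) (ℕₚ.+-identityʳ m)) (ℤₚ.+-inverseʳ (F m)))
∑-telescope (suc k) q m F = begin
  ∑ (allFin (suc k)) (λ i → F (m ℕ.+ toℕ i ℕ.* q) - F (m ℕ.+ toℕ i ℕ.* q ℕ.+ q))
    ≡⟨ ∑-allFin k (λ i → F (m ℕ.+ toℕ i ℕ.* q) - F (m ℕ.+ toℕ i ℕ.* q ℕ.+ q)) ⟩
  F (m ℕ.+ 0) - F (m ℕ.+ 0 ℕ.+ q) + ∑ (allFin k) (λ i → F (m ℕ.+ (q ℕ.+ toℕ i ℕ.* q)) - F (m ℕ.+ (q ℕ.+ toℕ i ℕ.* q) ℕ.+ q))
    ≡⟨ cong₂ _+_ (cong (λ x → F x - F (x ℕ.+ q)) (ℕₚ.+-identityʳ m))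
         (∑-cong (allFin k) (λ i → cong (λ x → F x - F (x ℕ.+ q)) (sym (ℕₚ.+-assoc m q (toℕ i ℕ.* q))))) ⟩
  F m - F (m ℕ.+ q) + ∑ (allFin k) (λ i → F (m ℕ.+ q ℕ.+ toℕ i ℕ.* q) - F (m ℕ.+ q ℕ.+ toℕ i ℕ.* q ℕ.+ q))
    ≡⟨ cong (_+_ (F m - F (m ℕ.+ q))) (∑-telescope k q (m ℕ.+ q) F) ⟩
  F m - F (m ℕ.+ q) + (F (m ℕ.+ q) - F (m ℕ.+ q ℕ.+ k ℕ.* q))
    ≡⟨ cancel (F m) (F (m ℕ.+ q)) _ ⟩
  F m - F (m ℕ.+ q ℕ.+ k ℕ.* q)
    ≡⟨ cong (λ x → F m - F x) (ℕₚ.+-assoc m q (k ℕ.* q)) ⟩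
  F m - F (m ℕ.+ suc k ℕ.* q) ∎
  where
  cancel : ∀ a b c → a - b + (b - c) ≡ a - c
  cancel = solveℤ

prime∣!⇒≤ : ∀ {p} → Prime p → ∀ b → p ∣ b ! → p ≤ b
prime∣!⇒≤ {p} pr zero    d = contradiction (∣⇒≤ d) λ p≤1 → small p pr p≤1
  where
  small : ∀ p → Prime p → ¬ p ≤ 1
  small 0 pr _ = ¬prime[0] pr
  small 1 pr _ = ¬prime[1] pr
  small (suc (suc _)) pr (s≤s ())
prime∣!⇒≤ {p} pr (suc b) d with euclidsLemma (suc b) (b !) pr d
... | inj₁ p∣b+1 = ∣⇒≤ p∣b+1
... | inj₂ p∣b!  = ℕₚ.m≤n⇒m≤1+n (prime∣!⇒≤ pr b p∣b!)

-- τ is the coefficient function of ∏ (1 − g^{−n/p}) in ℤ[C_n], over the primes p ≤ b dividing n.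
record Sieve (n b : ℕ) (τ : ℕ → ℤ) : Set where
  field
    periodic : ∀ m → τ (m ℕ.+ n) ≡ τ m
    at-0     : τ 0 ≡ 1ℤ
    support  : ∀ m → τ m ≢ 0ℤ → n ∣ m ℕ.* b !
    killed   : ∀ p q → Prime p → p ≤ b → n ≡ q ℕ.* p → ∀ m → ∑ (allFin p) (λ i → τ (m ℕ.+ toℕ i ℕ.* q)) ≡ 0ℤ

prime-divisor : ∀ r → r ≢ 0 → r ≢ 1 → ∃[ p ] Prime p × p ∣ r
prime-divisor r r≢0 r≢1 with factorise r {{ℕ.≢-nonZero r≢0}}
... | record { factors = [] ; isFactorisation = e } = contradiction e r≢1
... | record { factors = p ∷ ps ; isFactorisation = e ; factorsPrime = pr ∷ _ } = p , pr , subst (p ∣_) (sym e) (m∣m*n _)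

Period : (ℕ → ℤ) → ℕ → Set
Period G d = ∀ m → G (m ℕ.+ d) ≡ G m

period-* : ∀ {G d} → Period G d → ∀ k → Period G (k ℕ.* d)
period-* {G} {d} pd zero    m = cong G (ℕₚ.+-identityʳ m)
period-* {G} {d} pd (suc k) m = trans (cong G (sym (ℕₚ.+-assoc m d (k ℕ.* d)))) (trans (period-* pd k (m ℕ.+ d)) (pd m))

period-∸ : ∀ {G d e} → Period G (d ℕ.+ e) → Period G e → Period G d
period-∸ {G} {d} {e} p q m = trans (sym (q (m ℕ.+ d))) (trans (cong G (ℕₚ.+-assoc m d e)) (p m))

module _ (n : ℕ) (0<n : 0 < n) where

  sieve₀ : Sieve n 0 (λ m → ⟦ does (n ∣? m) ⟧)
  sieve₀ = record
    { periodic = λ m → cong ⟦_⟧ (does-⇔ (mk⇔ (λ d → ∣m+n∣m⇒∣n (subst (n ∣_) (ℕₚ.+-comm m n) d) ∣-refl) (λ d → ∣m∣n⇒∣m+n d ∣-refl))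
                                     (n ∣? (m ℕ.+ n)) (n ∣? m))
    ; at-0     = cong ⟦_⟧ (dec-true (n ∣? 0) (n ∣0))
    ; support  = support
    ; killed   = λ { 0 q pr _ → contradiction pr ¬prime[0] }
    }
    where
    support : ∀ m → ⟦ does (n ∣? m) ⟧ ≢ 0ℤ → n ∣ m ℕ.* 1
    support m τ≢0 with n ∣? m
    ... | yes d = ∣m⇒∣m*n 1 d
    ... | no ¬d = contradiction refl τ≢0

  sieve-skip : ∀ {b τ} → ¬ (Prime (suc b) × suc b ∣ n) → Sieve n b τ → Sieve n (suc b) τ
  sieve-skip {b} {τ} skip s = record
    { periodic = periodic
    ; at-0     = at-0
    ; support  = λ m τ≢0 → ∣-trans (support m τ≢0) (*-monoʳ-∣ m (n∣m*n (suc b)))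
    ; killed   = killed′
    }
    where
    open Sieve s
    killed′ : ∀ p q → Prime p → p ≤ suc b → n ≡ q ℕ.* p → ∀ m → ∑ (allFin p) (λ i → τ (m ℕ.+ toℕ i ℕ.* q)) ≡ 0ℤ
    killed′ p q pr p≤ e with ℕₚ.m≤n⇒m<n∨m≡n p≤
    ... | inj₁ (s≤s p≤b) = killed p q pr p≤b e
    ... | inj₂ refl      = contradiction (pr , divides q e) skip

  sieve-step : ∀ {b τ} → Prime (suc b) → ∀ q → n ≡ q ℕ.* suc b → Sieve n b τ →
               Sieve n (suc b) (λ m → τ m - τ (m ℕ.+ q))
  sieve-step {b} {τ} pr q n≡ s = record
    { periodic = λ m → cong₂ _-_ (periodic m) (trans (cong τ (+-swapʳ m n q)) (periodic (m ℕ.+ q)))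
    ; at-0     = trans (cong₂ _-_ at-0 τq≡0) refl
    ; support  = support′
    ; killed   = killed′
    }
    where
    open Sieve s
    q≢0 : ℕ.NonZero q
    q≢0 = ℕ.≢-nonZero λ { refl → ℕₚ.<⇒≢ 0<n (sym n≡) }
    τq≡0 : τ q ≡ 0ℤ
    τq≡0 with τ q ℤ.≟ 0ℤ
    ... | yes e = e
    ... | no  e = contradiction (prime∣!⇒≤ pr b (*-cancelˡ-∣ q {{q≢0}} (subst (_∣ q ℕ.* b !) n≡ (support q e)))) (ℕₚ.<⇒≱ (ℕₚ.n<1+n b))
    n∣q*! : n ∣ q ℕ.* suc b !
    n∣q*! = subst (_∣ q ℕ.* suc b !) (sym n≡) (*-monoʳ-∣ q (m∣m*n (b !)))
    support′ : ∀ m → τ m - τ (m ℕ.+ q) ≢ 0ℤ → n ∣ m ℕ.* suc b !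
    support′ m ne with τ m ℤ.≟ 0ℤ | τ (m ℕ.+ q) ℤ.≟ 0ℤ
    ... | no  e | _     = ∣-trans (support m e) (*-monoʳ-∣ m (n∣m*n (suc b)))
    ... | yes e | yes f = contradiction (cong₂ _-_ e f) ne
    ... | yes _ | no  f = ∣m+n∣m⇒∣n (subst (n ∣_) (trans (ℕₚ.*-distribʳ-+ (suc b !) m q) (ℕₚ.+-comm (m ℕ.* suc b !) _))
                            (∣-trans (support (m ℕ.+ q) f) (*-monoʳ-∣ (m ℕ.+ q) (n∣m*n (suc b))))) n∣q*!
    killed′ : ∀ p r → Prime p → p ≤ suc b → n ≡ r ℕ.* p → ∀ m →
              ∑ (allFin p) (λ i → τ (m ℕ.+ toℕ i ℕ.* r) - τ (m ℕ.+ toℕ i ℕ.* r ℕ.+ q)) ≡ 0ℤ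
    killed′ p r pr p≤ n≡′ m with ℕₚ.m≤n⇒m<n∨m≡n p≤
    ... | inj₁ (s≤s p≤b) = begin
      ∑ (allFin p) (λ i → τ (m ℕ.+ toℕ i ℕ.* r) - τ (m ℕ.+ toℕ i ℕ.* r ℕ.+ q))
        ≡⟨ ∑-- (allFin p) _ _ ⟩
      ∑ (allFin p) (λ i → τ (m ℕ.+ toℕ i ℕ.* r)) - ∑ (allFin p) (λ i → τ (m ℕ.+ toℕ i ℕ.* r ℕ.+ q))
        ≡⟨ cong₂ _-_ (killed p r pr p≤b n≡′ m)
             (trans (∑-cong (allFin p) (λ i → cong τ (+-swapʳ m (toℕ i ℕ.* r) q))) (killed p r pr p≤b n≡′ (m ℕ.+ q))) ⟩
      0ℤ ∎
    ... | inj₂ refl with refl ← ℕₚ.*-cancelʳ-≡ r q (suc b) (trans (sym n≡′) n≡) = begin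
      ∑ (allFin p) (λ i → τ (m ℕ.+ toℕ i ℕ.* r) - τ (m ℕ.+ toℕ i ℕ.* r ℕ.+ r)) ≡⟨ ∑-telescope p r m τ ⟩
      τ m - τ (m ℕ.+ p ℕ.* r)     ≡⟨ cong (λ x → τ m - τ (m ℕ.+ x)) (trans (ℕₚ.*-comm p r) (sym n≡)) ⟩
      τ m - τ (m ℕ.+ n)           ≡⟨ cong (_-_ (τ m)) (periodic m) ⟩
      τ m - τ m                   ≡⟨ ℤₚ.+-inverseʳ (τ m) ⟩
      0ℤ                          ∎

  sieve : ∀ b → ∃ (Sieve n b)
  sieve zero    = _ , sieve₀
  sieve (suc b) with prime? (suc b) | suc b ∣? n | sieve b
  ... | yes pr | yes (divides q e) | τ , s = _ , sieve-step pr q e s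
  ... | no ¬pr | _                 | τ , s = τ , sieve-skip (¬pr ∘ proj₁) s
  ... | yes _  | no ¬d             | τ , s = τ , sieve-skip (¬d ∘ proj₂) s

  -- The sieve gives vanishing sums only over cosets of prime order. For general `k`, the sum `G`
  -- has period `n`, and period `k` by telescoping, hence period d = gcd(k, n), a proper divisor of
  -- n. For a prime p dividing n/d, the number q = n/p is a multiple of d. So p · G(m) equals the
  -- sum of G(m + iq) over i < p, which vanishes after exchanging the sums.
  cyclotomic : ∃[ τ ] Cyclotomic n τ × τ 0 ≡ 1ℤ
  cyclotomic with τ , s ← sieve n =  τ , record { periodic = Sieve.periodic s ; balanced = λ m k ¬d → balanced k ¬d m } , Sieve.at-0 s
    where
    balanced : ∀ k → ¬ n ∣ k → ∀ m → ∑ (allFin n) (λ j → τ (m ℕ.+ toℕ j ℕ.* k)) ≡ 0ℤ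
    balanced k n∤k = vanish (Bézout.lemma k n)
      where
      open Sieve s
      G : ℕ → ℤ
      G m = ∑ (allFin n) (λ j → τ (m ℕ.+ toℕ j ℕ.* k))
      period-n : Period G n
      period-n m = ∑-cong (allFin n) (λ j → trans (cong τ (+-swapʳ m n (toℕ j ℕ.* k))) (periodic (m ℕ.+ toℕ j ℕ.* k)))
      period-k : Period G k
      period-k m = sym (ℤₚ.i-j≡0⇒i≡j _ _ (begin
        G m - G (m ℕ.+ k)
          ≡⟨ cong (_-_ (G m)) (∑-cong (allFin n) (λ j → cong τ (+-swapʳ m k (toℕ j ℕ.* k)))) ⟩
        G m - ∑ (allFin n) (λ j → τ (m ℕ.+ toℕ j ℕ.* k ℕ.+ k))
          ≡⟨ ∑-- (allFin n) _ _ ⟨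
        ∑ (allFin n) (λ j → τ (m ℕ.+ toℕ j ℕ.* k) - τ (m ℕ.+ toℕ j ℕ.* k ℕ.+ k))
          ≡⟨ ∑-telescope n k m τ ⟩
        τ m - τ (m ℕ.+ n ℕ.* k)
          ≡⟨ cong (λ x → τ m - τ (m ℕ.+ x)) (ℕₚ.*-comm n k) ⟩
        τ m - τ (m ℕ.+ k ℕ.* n)
          ≡⟨ cong (_-_ (τ m)) (period-* periodic k m) ⟩
        τ m - τ m
          ≡⟨ ℤₚ.+-inverseʳ (τ m) ⟩
        0ℤ ∎))
      -- Over ℕ the Bézout identity is d + y n = x k or d + x k = y n; in both forms `d` is a
      -- difference of two periods.
      period-gcd : ∀ {d} → Bézout.Identity d k n → Period G d
      period-gcd (Bézout.+- x y e) = period-∸ (subst (Period G) (sym e) (period-* period-k x)) (period-* period-n y)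
      period-gcd (Bézout.-+ x y e) = period-∸ (subst (Period G) (sym e) (period-* period-n y)) (period-* period-k x)
      vanish : Bézout.Lemma k n → ∀ m → G m ≡ 0ℤ
      vanish (Bézout.result d g b) m with GCD.gcd∣n g
      ... | divides r n≡rd with prime-divisor r r≢0 r≢1
        where
        r≢0 : r ≢ 0
        r≢0 refl = ℕₚ.<⇒≢ 0<n (sym n≡rd)
        r≢1 : r ≢ 1
        r≢1 refl = n∤k (subst (_∣ k) (sym (trans n≡rd (ℕₚ.*-identityˡ d))) (GCD.gcd∣m g))
      ... | p , pr , divides t r≡tp = [ (λ e → contradiction (ℤₚ.+-injective e) p≢0) , id ]′ (ℤₚ.i*j≡0⇒i≡0∨j≡0 (+ p) p*G≡0)
        where
        q : ℕ
        q = t ℕ.* d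
        reorder : ∀ t p d → t ℕ.* p ℕ.* d ≡ t ℕ.* d ℕ.* p
        reorder = solve-∀
        n≡qp : n ≡ q ℕ.* p
        n≡qp = trans n≡rd (trans (cong (ℕ._* d) r≡tp) (reorder t p d))
        p≢0 : p ≢ 0
        p≢0 refl = ¬prime[0] pr
        p≤n : p ≤ n
        p≤n = ∣⇒≤ {{ℕ.>-nonZero 0<n}} (divides q n≡qp)
        p*G≡0 : + p * G m ≡ 0ℤ
        p*G≡0 = begin
          + p * G m
            ≡⟨ ∑-const p (G m) ⟨
          ∑ (allFin p) (λ _ → G m)
            ≡⟨ ∑-cong (allFin p) (λ i → period-* (period-* (period-gcd b) t) (toℕ i) m) ⟨
          ∑ (allFin p) (λ i → ∑ (allFin n) (λ j → τ (m ℕ.+ toℕ i ℕ.* q ℕ.+ toℕ j ℕ.* k)))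
            ≡⟨ ∑-swap (allFin p) (allFin n) _ ⟩
          ∑ (allFin n) (λ j → ∑ (allFin p) (λ i → τ (m ℕ.+ toℕ i ℕ.* q ℕ.+ toℕ j ℕ.* k)))
            ≡⟨ ∑-zero (allFin n) (λ j → trans (∑-cong (allFin p) (λ i → cong τ (+-swapʳ m (toℕ i ℕ.* q) (toℕ j ℕ.* k))))
                                              (killed p q pr p≤n n≡qp (m ℕ.+ toℕ j ℕ.* k))) ⟩
          0ℤ ∎

-- Elementary symmetric functions

∑-cong-All : {A : Set} {xs : List A} {f g : A → ℤ} → All (λ x → f x ≡ g x) xs → ∑ xs f ≡ ∑ xs g
∑-cong-All []       = refl
∑-cong-All (e ∷ es) = cong₂ _+_ e (∑-cong-All es)

∑-pick : ∀ {n} (i : Fin n) (g : Fin n → ℤ) → ∑ (allFin n) (λ j → ⟦ finEq i j ⟧ * g j) ≡ g i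
∑-pick {suc n} zero g = begin
  ∑ (allFin (suc n)) (λ j → ⟦ finEq zero j ⟧ * g j)          ≡⟨ ∑-allFin n (λ j → ⟦ finEq zero j ⟧ * g j) ⟩
  1ℤ * g zero + ∑ (allFin n) (λ j → 0ℤ * g (suc j))          ≡⟨ cong₂ _+_ (ℤₚ.*-identityˡ (g zero)) (∑-zero (allFin n) (λ j → ℤₚ.*-zeroˡ (g (suc j)))) ⟩
  g zero + 0ℤ                                                ≡⟨ ℤₚ.+-identityʳ (g zero) ⟩
  g zero                                                     ∎
∑-pick {suc n} (suc i) g = begin
  ∑ (allFin (suc n)) (λ j → ⟦ finEq (suc i) j ⟧ * g j)               ≡⟨ ∑-allFin n (λ j → ⟦ finEq (suc i) j ⟧ * g j) ⟩
  0ℤ * g zero + ∑ (allFin n) (λ j → ⟦ finEq i j ⟧ * g (suc j))       ≡⟨ cong₂ _+_ (ℤₚ.*-zeroˡ (g zero)) (∑-pick i (g ∘ suc)) ⟩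
  0ℤ + g (suc i)                                                     ≡⟨ ℤₚ.+-identityˡ _ ⟩
  g (suc i)                                                          ∎

-- A finite stand-in for all exponent vectors. With `B` above every exponent that occurs, summing
-- coefficients over it evaluates the whole polynomial in `k` variables.
box : ℕ → (k : ℕ) → List (Vec ℕ k)
box B = vecs (map toℕ (allFin B))

∑-box : ∀ B k (c : Fin k → ℕ) → (∀ j → c j < B) → (f : Vec ℕ k → ℤ) →
        ∑ (box B k) (λ α → ⟦ allᵇ (λ j → c j ≡ᵇ lookup α j) (allFin k) ⟧ * f α) ≡ f (Vec.tabulate c)
∑-box B zero    c c<B f = trans (ℤₚ.+-identityʳ _) (ℤₚ.*-identityˡ _)
∑-box B (suc k) c c<B f = begin
  ∑ (box B (suc k)) (λ α → match α * f α)
    ≡⟨ ∑-vecs (map toℕ (allFin B)) k (λ α → match α * f α) ⟩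
  ∑ (map toℕ (allFin B)) (λ x → ∑ (box B k) (λ α → match (x ∷ α) * f (x ∷ α)))
    ≡⟨ ∑-map toℕ (allFin B) _ ⟩
  ∑ (allFin B) (λ i → ∑ (box B k) (λ α → match (toℕ i ∷ α) * f (toℕ i ∷ α)))
    ≡⟨ ∑-cong (allFin B) (λ i → trans (∑-cong (box B k) (split i))
         (∑-*ˡ (box B k) ⟦ finEq (fromℕ< (c<B zero)) i ⟧ (λ α → match′ α * f (toℕ i ∷ α)))) ⟩
  ∑ (allFin B) (λ i → ⟦ finEq (fromℕ< (c<B zero)) i ⟧ * ∑ (box B k) (λ α → match′ α * f (toℕ i ∷ α)))
    ≡⟨ ∑-pick (fromℕ< (c<B zero)) _ ⟩
  ∑ (box B k) (λ α → match′ α * f (toℕ (fromℕ< (c<B zero)) ∷ α))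
    ≡⟨ ∑-box B k (c ∘ suc) (c<B ∘ suc) _ ⟩
  f (toℕ (fromℕ< (c<B zero)) ∷ Vec.tabulate (c ∘ suc))
    ≡⟨ cong (λ x → f (x ∷ Vec.tabulate (c ∘ suc))) (Finₚ.toℕ-fromℕ< (c<B zero)) ⟩
  f (Vec.tabulate c) ∎
  where
  match : Vec ℕ (suc k) → ℤ
  match α = ⟦ allᵇ (λ j → c j ≡ᵇ lookup α j) (allFin (suc k)) ⟧
  match′ : Vec ℕ k → ℤ
  match′ α = ⟦ allᵇ (λ j → c (suc j) ≡ᵇ lookup α j) (allFin k) ⟧
  split : ∀ i α → match (toℕ i ∷ α) * f (toℕ i ∷ α) ≡
                  ⟦ finEq (fromℕ< (c<B zero)) i ⟧ * (match′ α * f (toℕ i ∷ α))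
  split i α = begin
    match (toℕ i ∷ α) * f (toℕ i ∷ α)
      ≡⟨ cong (λ b → ⟦ b ⟧ * f (toℕ i ∷ α)) (allᵇ-allFin k (λ j → c j ≡ᵇ lookup (toℕ i ∷ α) j)) ⟩
    ⟦ (c zero ≡ᵇ toℕ i) ∧ _ ⟧ * f (toℕ i ∷ α)
      ≡⟨ cong (_* f (toℕ i ∷ α)) (⟦⟧-∧ (c zero ≡ᵇ toℕ i) _) ⟩
    ⟦ c zero ≡ᵇ toℕ i ⟧ * match′ α * f (toℕ i ∷ α)
      ≡⟨ ℤₚ.*-assoc ⟦ c zero ≡ᵇ toℕ i ⟧ _ _ ⟩
    ⟦ c zero ≡ᵇ toℕ i ⟧ * (match′ α * f (toℕ i ∷ α))
      ≡⟨ cong (λ x → ⟦ x ≡ᵇ toℕ i ⟧ * (match′ α * f (toℕ i ∷ α))) (Finₚ.toℕ-fromℕ< (c<B zero)) ⟨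
    ⟦ finEq (fromℕ< (c<B zero)) i ⟧ * (match′ α * f (toℕ i ∷ α)) ∎

-- Both `coeffX` and `coeffE` count objects (colourings, tuples of subsets) with a prescribed
-- content. Exchanging the sums turns a pairing with such coefficients into a sum over the objects
-- themselves, as each content occurs exactly once in the box.
∑-by-content : ∀ {O : Set} B k (os : List O) (w : O → ℤ) (c : O → Fin k → ℕ) → All (λ o → ∀ j → c o j < B) os →
  (g : Vec ℕ k → ℤ) →
  ∑ (box B k) (λ α → g α * ∑ os (λ o → w o * ⟦ allᵇ (λ j → c o j ≡ᵇ lookup α j) (allFin k) ⟧)) ≡
  ∑ os (λ o → w o * g (Vec.tabulate (c o)))
∑-by-content B k os w c c<B g = begin
  ∑ (box B k) (λ α → g α * ∑ os (λ o → w o * match o α))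
    ≡⟨ ∑-cong (box B k) (λ α → ∑-*ˡ os (g α) _) ⟨
  ∑ (box B k) (λ α → ∑ os (λ o → g α * (w o * match o α)))
    ≡⟨ ∑-swap (box B k) os _ ⟩
  ∑ os (λ o → ∑ (box B k) (λ α → g α * (w o * match o α)))
    ≡⟨ ∑-cong os (λ o → trans (∑-cong (box B k) (λ α → rotate (g α) (w o) (match o α))) (∑-*ˡ (box B k) (w o) _)) ⟩
  ∑ os (λ o → w o * ∑ (box B k) (λ α → match o α * g α))
    ≡⟨ ∑-cong-All (All.map (λ {o} c<B → cong (w o *_) (∑-box B k (c o) c<B g)) c<B) ⟩
  ∑ os (λ o → w o * g (Vec.tabulate (c o))) ∎
  where
  match : _ → Vec ℕ k → ℤ
  match o α = ⟦ allᵇ (λ j → c o j ≡ᵇ lookup α j) (allFin k) ⟧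
  rotate : ∀ a b c → a * (b * c) ≡ b * (c * a)
  rotate = solveℤ

-- At x_j = ζʲ the monomial x^α takes the value ζ to the power `weight α`.
weight : ∀ {k} → Vec ℕ k → ℕ
weight {k} α = Sumℕ.∑ (allFin k) (λ j → toℕ j ℕ.* lookup α j)

-- el l a p F = Σ F(j₁ + ⋯ + j_p) over a ≤ j₁ < ⋯ < j_p < a + l, i.e. e_p(ζᵃ, …, ζ^{a+l−1}) under ζᵐ ↦ F m.
el : (l a p : ℕ) → (ℕ → ℤ) → ℤ
el l       a zero    F = F 0
el zero    a (suc p) F = 0ℤ
el (suc l) a (suc p) F = el l (suc a) p (λ m → F (a ℕ.+ m)) + el l (suc a) (suc p) F

el-cong : ∀ l a p {F G : ℕ → ℤ} → (∀ m → F m ≡ G m) → el l a p F ≡ el l a p G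
el-cong l       a zero    e = e 0
el-cong zero    a (suc p) e = refl
el-cong (suc l) a (suc p) e = cong₂ _+_ (el-cong l (suc a) p (λ m → e (a ℕ.+ m))) (el-cong l (suc a) (suc p) e)

el-∑ : ∀ {A : Set} l a p (xs : List A) (F : A → ℕ → ℤ) →
       ∑ xs (λ x → el l a p (F x)) ≡ el l a p (λ m → ∑ xs (λ x → F x m))
el-∑ l       a zero    xs F = refl
el-∑ zero    a (suc p) xs F = ∑-0 xs
el-∑ (suc l) a (suc p) xs F = trans (∑-+ xs _ _)
  (cong₂ _+_ (el-∑ l (suc a) p xs (λ x m → F x (a ℕ.+ m))) (el-∑ l (suc a) (suc p) xs F))

el-0 : ∀ l a p {F : ℕ → ℤ} → (∀ m → F m ≡ 0ℤ) → el l a p F ≡ 0ℤ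
-- The zero function is an empty sum of functions, so this is a case of linearity.
el-0 l a p e = trans (el-cong l a p e) (sym (el-∑ l a p [] (λ (_ : ℕ) _ → 0ℤ)))

el-large : ∀ l a p F → l < p → el l a p F ≡ 0ℤ
el-large zero    a (suc p) F _         = refl
el-large (suc l) a (suc p) F (s≤s l<p) = cong₂ _+_ (el-large l (suc a) p _ l<p) (el-large l (suc a) (suc p) F (ℕₚ.m≤n⇒m≤1+n l<p))

interval : ℕ → ℕ → ℕ
interval zero    a = 0
interval (suc l) a = a ℕ.+ interval l (suc a)

-- Gauss's sum without subtraction or division. For a = 0 and l = n it reads 2s + n = n², where e_n
-- takes the value ζˢ; hence e_n² becomes 1 although e_n itself may be -1.
interval-double : ∀ l a → interval l a ℕ.+ interval l a ℕ.+ l ≡ l ℕ.* (a ℕ.+ a ℕ.+ l)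
interval-double zero    a = refl
interval-double (suc l) a = begin
  a ℕ.+ s ℕ.+ (a ℕ.+ s) ℕ.+ suc l              ≡⟨ lemma₁ a s l ⟩
  a ℕ.+ a ℕ.+ 1 ℕ.+ (s ℕ.+ s ℕ.+ l)            ≡⟨ cong (a ℕ.+ a ℕ.+ 1 ℕ.+_) (interval-double l (suc a)) ⟩
  a ℕ.+ a ℕ.+ 1 ℕ.+ l ℕ.* (suc a ℕ.+ suc a ℕ.+ l) ≡⟨ lemma₂ a l ⟩
  suc l ℕ.* (a ℕ.+ a ℕ.+ suc l)                ∎
  where
  s : ℕ
  s = interval l (suc a)
  lemma₁ : ∀ a s l → a ℕ.+ s ℕ.+ (a ℕ.+ s) ℕ.+ suc l ≡ a ℕ.+ a ℕ.+ 1 ℕ.+ (s ℕ.+ s ℕ.+ l)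
  lemma₁ = solve-∀
  lemma₂ : ∀ a l → a ℕ.+ a ℕ.+ 1 ℕ.+ l ℕ.* (suc a ℕ.+ suc a ℕ.+ l) ≡ suc l ℕ.* (a ℕ.+ a ℕ.+ suc l)
  lemma₂ = solve-∀

el-full : ∀ l a F → el l a l F ≡ F (interval l a)
el-full zero    a F = refl
el-full (suc l) a F = trans (cong₂ _+_ (el-full l (suc a) _) (el-large l (suc a) (suc l) F ℕₚ.≤-refl)) (ℤₚ.+-identityʳ _)

-- The recursion of `el` removes the first root; here the last one is removed. A rotation of the
-- roots takes away the first and appends a new last one, so both forms are needed.
el-last : ∀ l a p F → el (suc l) a (suc p) F ≡ el l a p (λ m → F (a ℕ.+ l ℕ.+ m)) + el l a (suc p) F
el-last zero a zero    F = cong (λ x → F x + 0ℤ) (cong (ℕ._+ 0) (sym (ℕₚ.+-identityʳ a)))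
el-last zero a (suc p) F = refl
el-last (suc l) a zero F = begin
  A + el (suc l) (suc a) 1 F                                ≡⟨ cong (_+_ A) (el-last l (suc a) zero F) ⟩
  A + (el l (suc a) zero (λ m → F (suc a ℕ.+ l ℕ.+ m)) + C) ≡⟨ swap A (F (suc a ℕ.+ l ℕ.+ 0)) C ⟩
  el l (suc a) zero (λ m → F (suc a ℕ.+ l ℕ.+ m)) + (A + C) ≡⟨ cong (_+ (A + C)) (el-cong l (suc a) zero (λ m → cong (λ x → F (x ℕ.+ m)) (sym (ℕₚ.+-suc a l)))) ⟩
  el l (suc a) zero (λ m → F (a ℕ.+ suc l ℕ.+ m)) + (A + C) ∎
  where
  A C : ℤ
  A = el l (suc a) zero (λ m → F (a ℕ.+ m))
  C = el l (suc a) 1 F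
  swap : ∀ x y z → x + (y + z) ≡ y + (x + z)
  swap = solveℤ
el-last (suc l) a (suc p) F = begin
  el (suc l) (suc a) (suc p) (λ m → F (a ℕ.+ m)) + el (suc l) (suc a) (suc (suc p)) F
    ≡⟨ cong₂ _+_ (el-last l (suc a) p _) (el-last l (suc a) (suc p) F) ⟩
  (el l (suc a) p (λ m → F (a ℕ.+ (suc a ℕ.+ l ℕ.+ m))) + B) + (el l (suc a) (suc p) (λ m → F (suc a ℕ.+ l ℕ.+ m)) + D)
    ≡⟨ cong₂ (λ x y → x + B + (y + D)) (el-cong l (suc a) p (λ m → cong F (arith a l m)))
                                       (el-cong l (suc a) (suc p) (λ m → cong (λ x → F (x ℕ.+ m)) (sym (ℕₚ.+-suc a l)))) ⟩
  (A′ + B) + (C′ + D)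
    ≡⟨ swap A′ B C′ D ⟩
  (A′ + C′) + (B + D) ∎
  where
  A′ B C′ D : ℤ
  A′ = el l (suc a) p (λ m → F (a ℕ.+ suc l ℕ.+ (a ℕ.+ m)))
  B  = el l (suc a) (suc p) (λ m → F (a ℕ.+ m))
  C′ = el l (suc a) (suc p) (λ m → F (a ℕ.+ suc l ℕ.+ m))
  D  = el l (suc a) (suc (suc p)) F
  arith : ∀ a l m → a ℕ.+ (suc a ℕ.+ l ℕ.+ m) ≡ a ℕ.+ suc l ℕ.+ (a ℕ.+ m)
  arith = solve-∀
  swap : ∀ x y z w → x + y + (z + w) ≡ x + z + (y + w)
  swap = solveℤ

-- Homogeneity: multiplying every root by ζ multiplies e_p by ζᵖ.
el-shift : ∀ l a p F → el l (suc a) p F ≡ el l a p (λ m → F (p ℕ.+ m))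
el-shift l       a zero    F = refl
el-shift zero    a (suc p) F = refl
el-shift (suc l) a (suc p) F = cong₂ _+_
  (trans (el-shift l (suc a) p _) (el-cong l (suc a) p (λ m → cong F (arith a p m))))
  (el-shift l (suc a) (suc p) F)
  where
  arith : ∀ a p m → suc a ℕ.+ (p ℕ.+ m) ≡ suc p ℕ.+ (a ℕ.+ m)
  arith = solve-∀

total : ∀ {l} → ℕ → Vec Bool l → ℕ
total {l} a S = Sumℕ.∑ (allFin l) (λ j → (a ℕ.+ toℕ j) ℕ.* Sumℕ.⟦ lookup S j ⟧)

total-∷ : ∀ {l} a b (S : Vec Bool l) → total a (b ∷ S) ≡ a ℕ.* Sumℕ.⟦ b ⟧ ℕ.+ total (suc a) S
total-∷ {l} a b S = trans (Sumℕ.∑-allFin l (λ j → (a ℕ.+ toℕ j) ℕ.* Sumℕ.⟦ lookup (b ∷ S) j ⟧))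
  (cong₂ ℕ._+_ (cong (ℕ._* Sumℕ.⟦ b ⟧) (ℕₚ.+-identityʳ a))
               (Sumℕ.∑-cong (allFin l) (λ j → cong (ℕ._* Sumℕ.⟦ lookup S j ⟧) (ℕₚ.+-suc a (toℕ j)))))

subsetSize-∷ : ∀ {l} b (S : Vec Bool l) → subsetSize (b ∷ S) ≡ Sumℕ.⟦ b ⟧ ℕ.+ subsetSize S
subsetSize-∷ {l} b S = trans (length-filterᵇ (lookup (b ∷ S)) (allFin (suc l)))
  (trans (Sumℕ.∑-allFin l (λ j → Sumℕ.⟦ lookup (b ∷ S) j ⟧)) (cong (Sumℕ.⟦ b ⟧ ℕ.+_) (sym (length-filterᵇ (lookup S) (allFin l)))))

-- Splitting on whether the first index belongs to `S` reproduces the recursion of `el`, where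
-- `total a S` is the exponent of the monomial that belongs to `S`.
∑-subsets : ∀ l a p (F : ℕ → ℤ) →
  ∑ (vecs (true ∷ false ∷ []) l) (λ S → ⟦ subsetSize S ≡ᵇ p ⟧ * F (total a S)) ≡ el l a p F
∑-subsets zero    a zero    F = trans (ℤₚ.+-identityʳ _) (ℤₚ.*-identityˡ _)
∑-subsets zero    a (suc p) F = refl
∑-subsets (suc l) a p       F = begin
  ∑ (vecs Bs (suc l)) (λ S → ⟦ subsetSize S ≡ᵇ p ⟧ * F (total a S))
    ≡⟨ ∑-vecs Bs l _ ⟩
  ∑ (vecs Bs l) (λ S → ⟦ subsetSize (true ∷ S) ≡ᵇ p ⟧ * F (total a (true ∷ S))) +
  (∑ (vecs Bs l) (λ S → ⟦ subsetSize (false ∷ S) ≡ᵇ p ⟧ * F (total a (false ∷ S))) + 0ℤ)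
    ≡⟨ cong₂ _+_ (∑-cong (vecs Bs l) (λ S → cong₂ (λ x y → ⟦ x ≡ᵇ p ⟧ * F y) (subsetSize-∷ true S)
                                              (trans (total-∷ a true S) (cong (ℕ._+ total (suc a) S) (ℕₚ.*-identityʳ a)))))
                 (trans (ℤₚ.+-identityʳ _)
                   (∑-cong (vecs Bs l) (λ S → cong₂ (λ x y → ⟦ x ≡ᵇ p ⟧ * F y) (subsetSize-∷ false S)
                                              (trans (total-∷ a false S) (cong (ℕ._+ total (suc a) S) (ℕₚ.*-zeroʳ a)))))) ⟩
  ∑ (vecs Bs l) (λ S → ⟦ suc (subsetSize S) ≡ᵇ p ⟧ * F (a ℕ.+ total (suc a) S)) +
  ∑ (vecs Bs l) (λ S → ⟦ subsetSize S ≡ᵇ p ⟧ * F (total (suc a) S))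
    ≡⟨ by-size p ⟩
  el (suc l) a p F ∎
  where
  Bs : List Bool
  Bs = true ∷ false ∷ []
  by-size : ∀ p → ∑ (vecs Bs l) (λ S → ⟦ suc (subsetSize S) ≡ᵇ p ⟧ * F (a ℕ.+ total (suc a) S)) +
                  ∑ (vecs Bs l) (λ S → ⟦ subsetSize S ≡ᵇ p ⟧ * F (total (suc a) S)) ≡ el (suc l) a p F
  by-size zero = trans (cong₂ _+_ (∑-zero (vecs Bs l) (λ S → ℤₚ.*-zeroˡ (F (a ℕ.+ total (suc a) S)))) (∑-subsets l (suc a) zero F)) (ℤₚ.+-identityˡ _)
  by-size (suc p) = cong₂ _+_ (∑-subsets l (suc a) p (λ m → F (a ℕ.+ m))) (∑-subsets l (suc a) (suc p) F)

-- Multiplying every n-th root of unity by ζ permutes them.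
el-rotate : ∀ n p {F} → (∀ m → F (m ℕ.+ n) ≡ F m) → el n 0 p F ≡ el n 0 p (λ m → F (p ℕ.+ m))
el-rotate n       zero    periodic = refl
el-rotate zero    (suc p) periodic = refl
el-rotate (suc l) (suc p) {F} periodic = begin
  el l 1 p F + el l 1 (suc p) F
    ≡⟨ cong (_+ el l 1 (suc p) F) (el-cong l 1 p (λ m → trans (sym (periodic m)) (cong F (ℕₚ.+-comm m (suc l))))) ⟩
  el l 1 p (λ m → F (1 ℕ.+ l ℕ.+ m)) + el l 1 (suc p) F
    ≡⟨ el-last l 1 p F ⟨
  el (suc l) 1 (suc p) F
    ≡⟨ el-shift (suc l) 0 (suc p) F ⟩
  el (suc l) 0 (suc p) (λ m → F (suc p ℕ.+ m)) ∎

module Elementary (n : ℕ) (0<n : 0 < n) where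

  -- The functional applied to e_{p₁} e_{p₂} ⋯ at the roots of unity. The exponent `m` contributed
  -- by one factor becomes a translation of the function handed to the remaining factors.
  ev : List ℕ → (ℕ → ℤ) → ℤ
  ev []       F = F 0
  ev (p ∷ ps) F = el n 0 p (λ m → ev ps (λ m′ → F (m ℕ.+ m′)))

  ev-cong : ∀ ps {F G : ℕ → ℤ} → (∀ m → F m ≡ G m) → ev ps F ≡ ev ps G
  ev-cong []       e = e 0
  ev-cong (p ∷ ps) e = el-cong n 0 p (λ m → ev-cong ps (λ m′ → e (m ℕ.+ m′)))

  ev-∑ : ∀ {A : Set} ps (xs : List A) (F : A → ℕ → ℤ) → ∑ xs (λ x → ev ps (F x)) ≡ ev ps (λ m → ∑ xs (λ x → F x m))
  ev-∑ []       xs F = refl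
  ev-∑ (p ∷ ps) xs F = trans (el-∑ n 0 p xs _) (el-cong n 0 p (λ m → ev-∑ ps xs (λ x m′ → F x (m ℕ.+ m′))))

  -- Multiplication by the remaining factors followed by ℓ is again a linear functional, so facts
  -- about a single `el` apply to the first factor of a product.
  ev-cyclotomic : ∀ ps {F} → Cyclotomic n F → Cyclotomic n (λ m → ev ps (λ m′ → F (m ℕ.+ m′)))
  ev-cyclotomic ps {F} cyc = record
    { periodic = λ m → ev-cong ps (λ m′ → trans (cong F (+-swapʳ m n m′)) (periodic (m ℕ.+ m′)))
    ; balanced = λ m k n∤k → begin
        ∑ (allFin n) (λ j → ev ps (λ m′ → F (m ℕ.+ toℕ j ℕ.* k ℕ.+ m′)))
          ≡⟨ ev-∑ ps (allFin n) _ ⟩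
        ev ps (λ m′ → ∑ (allFin n) (λ j → F (m ℕ.+ toℕ j ℕ.* k ℕ.+ m′)))
          ≡⟨ ev-cong ps (λ m′ → trans (∑-cong (allFin n) (λ j → cong F (+-swapʳ m (toℕ j ℕ.* k) m′))) (balanced (m ℕ.+ m′) k n∤k)) ⟩
        ev ps (λ _ → 0ℤ)
          ≡⟨ ev-∑ ps [] (λ (_ : ℕ) _ → 0ℤ) ⟨
        0ℤ ∎
    }
    where
    open Cyclotomic cyc

  el-rotate* : ∀ p j {F} → (∀ m → F (m ℕ.+ n) ≡ F m) → el n 0 p F ≡ el n 0 p (λ m → F (m ℕ.+ j ℕ.* p))
  el-rotate* p zero    {F} periodic = el-cong n 0 p (λ m → cong F (sym (ℕₚ.+-identityʳ m)))
  el-rotate* p (suc j) {F} periodic = begin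
    el n 0 p F
      ≡⟨ el-rotate* p j periodic ⟩
    el n 0 p (λ m → F (m ℕ.+ j ℕ.* p))
      ≡⟨ el-rotate n p (λ m → trans (cong F (+-swapʳ m n (j ℕ.* p))) (periodic (m ℕ.+ j ℕ.* p))) ⟩
    el n 0 p (λ m → F (p ℕ.+ m ℕ.+ j ℕ.* p))
      ≡⟨ el-cong n 0 p (λ m → cong F (arith p m (j ℕ.* p))) ⟩
    el n 0 p (λ m → F (m ℕ.+ suc j ℕ.* p)) ∎
    where
    arith : ∀ a b c → a ℕ.+ b ℕ.+ c ≡ b ℕ.+ (a ℕ.+ c)
    arith = solve-∀

  -- Rotation gives e_p = ζ^{jp} e_p for every j. Summed over j < n, the left side is n e_p and the
  -- right side is 0, because the powers ζ^{jp} add up to 0.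
  el-nondivisible : ∀ p {F} → Cyclotomic n F → ¬ n ∣ p → el n 0 p F ≡ 0ℤ
  el-nondivisible p {F} cyc n∤p = [ (λ e → contradiction (sym (ℤₚ.+-injective e)) (ℕₚ.<⇒≢ 0<n)) , id ]′ (ℤₚ.i*j≡0⇒i≡0∨j≡0 (+ n) (begin
    + n * el n 0 p F
      ≡⟨ ∑-const n _ ⟨
    ∑ (allFin n) (λ _ → el n 0 p F)
      ≡⟨ ∑-cong (allFin n) (λ j → el-rotate* p (toℕ j) periodic) ⟩
    ∑ (allFin n) (λ j → el n 0 p (λ m → F (m ℕ.+ toℕ j ℕ.* p)))
      ≡⟨ el-∑ n 0 p (allFin n) _ ⟩
    el n 0 p (λ m → ∑ (allFin n) (λ j → F (m ℕ.+ toℕ j ℕ.* p)))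
      ≡⟨ el-0 n 0 p (λ m → balanced m p n∤p) ⟩
    0ℤ ∎))
    where open Cyclotomic cyc

  el-vanish : ∀ p {F} → Cyclotomic n F → 0 < p → p ≢ n → el n 0 p F ≡ 0ℤ
  el-vanish p {F} cyc 0<p p≢n with ℕₚ.<-cmp p n
  ... | tri< p<n _ _ = el-nondivisible p cyc (>⇒∤ {{ℕ.>-nonZero 0<p}} p<n)
  ... | tri≈ _ p≡n _ = contradiction p≡n p≢n
  ... | tri> _ _ n<p = el-large n 0 p F n<p

  ev-nonneg : ∀ {τ} → Cyclotomic n τ → τ 0 ≡ 1ℤ → ∀ ps → sum ps ≡ n ℕ.+ n → All (1 ≤_) ps → 0ℤ ℤ.≤ ev ps τ
  ev-nonneg {τ} cyc τ0 [] e _ = contradiction e (ℕₚ.<⇒≢ (ℕₚ.≤-trans 0<n (ℕₚ.m≤m+n n n)))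
  ev-nonneg {τ} cyc τ0 (p ∷ ps) e (0<p ∷ pos) with p ℕₚ.≟ n
  ... | no p≢n = ℤₚ.≤-reflexive (sym (el-vanish p (ev-cyclotomic ps cyc) 0<p p≢n))
  ... | yes refl = rest ps (ℕₚ.+-cancelˡ-≡ n _ _ e) pos
    where
    rest : ∀ qs → sum qs ≡ n → All (1 ≤_) qs → 0ℤ ℤ.≤ ev (n ∷ qs) τ
    rest [] e′ _ = contradiction e′ (ℕₚ.<⇒≢ 0<n)
    rest (q ∷ qs) e′ (0<q ∷ pos′) with q ℕₚ.≟ n
    ... | no q≢n = ℤₚ.≤-reflexive (sym (el-0 n 0 n (λ m → el-vanish q (ev-cyclotomic qs (cyclotomic-translate cyc m)) 0<q q≢n)))
    rest (q ∷ []) e′ _ | yes refl = subst (0ℤ ℤ.≤_) (sym value) (ℤ.+≤+ z≤n)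
      where
      s : ℕ
      s = interval n 0
      period* : ∀ k → τ (k ℕ.* n) ≡ τ 0
      period* k = period-* (Cyclotomic.periodic cyc) k 0
      value : ev (n ∷ n ∷ []) τ ≡ 1ℤ
      value = begin
        el n 0 n (λ m → el n 0 n (λ m′ → τ (m ℕ.+ (m′ ℕ.+ 0))))
          ≡⟨ trans (el-full n 0 _) (el-full n 0 _) ⟩
        τ (s ℕ.+ (s ℕ.+ 0))
          ≡⟨ cong (λ x → τ (s ℕ.+ x)) (ℕₚ.+-identityʳ s) ⟩
        τ (s ℕ.+ s)
          -- One more period turns the exponent 2s into 2s + n = n², a multiple of n.
          ≡⟨ Cyclotomic.periodic cyc (s ℕ.+ s) ⟨
        τ (s ℕ.+ s ℕ.+ n)
          ≡⟨ cong τ (interval-double n 0) ⟩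
        τ (n ℕ.* n)
          ≡⟨ period* n ⟩
        τ 0
          ≡⟨ τ0 ⟩
        1ℤ ∎
    rest (q ∷ r ∷ qs) e′ (_ ∷ 0<r ∷ _) | yes refl =
      contradiction (ℕₚ.m+n≡0⇒m≡0 r (ℕₚ.+-cancelˡ-≡ n _ _ (trans e′ (sym (ℕₚ.+-identityʳ n))))) (ℕₚ.<⇒≢ 0<r ∘ sym)

  ∑-eTuples : ∀ ps F → ∑ (eTuples n ps) (λ t → F (Sumℕ.∑ t (total 0))) ≡ ev ps F
  ∑-eTuples []       F = ℤₚ.+-identityʳ _
  ∑-eTuples (p ∷ ps) F = begin
    ∑ (eTuples n (p ∷ ps)) (λ t → F (Sumℕ.∑ t (total 0)))
      ≡⟨ ∑-concatMap _ (subsetsOfSize n p) _ ⟩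
    ∑ (subsetsOfSize n p) (λ S → ∑ (map (S ∷_) (eTuples n ps)) (λ t → F (Sumℕ.∑ t (total 0))))
      ≡⟨ ∑-cong (subsetsOfSize n p) (λ S → trans (∑-map (S ∷_) (eTuples n ps) _) (∑-eTuples ps (λ m → F (total 0 S ℕ.+ m)))) ⟩
    ∑ (subsetsOfSize n p) (λ S → ev ps (λ m → F (total 0 S ℕ.+ m)))
      ≡⟨ ∑-filter _ (vecs (true ∷ false ∷ []) n) _ ⟩
    ∑ (vecs (true ∷ false ∷ []) n) (λ S → ⟦ subsetSize S ≡ᵇ p ⟧ * ev ps (λ m → F (total 0 S ℕ.+ m)))
      ≡⟨ ∑-subsets n 0 p (λ x → ev ps (λ m → F (x ℕ.+ m))) ⟩
    ev (p ∷ ps) F ∎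

  length-eTuples : ∀ ps → All (λ t → length t ≡ length ps) (eTuples n ps)
  length-eTuples []       = refl ∷ []
  length-eTuples (p ∷ ps) = Allₚ.concat⁺ (Allₚ.map⁺ (All.universal (λ S → Allₚ.map⁺ (All.map (cong suc) (length-eTuples ps))) (subsetsOfSize n p)))

  weight-multiplicity : ∀ t → weight (Vec.tabulate (λ j → multiplicity j t)) ≡ Sumℕ.∑ t (total {n} 0)
  weight-multiplicity t = begin
    Sumℕ.∑ (allFin n) (λ j → toℕ j ℕ.* lookup (Vec.tabulate (λ j → multiplicity j t)) j)
      ≡⟨ Sumℕ.∑-cong (allFin n) (λ j → cong (toℕ j ℕ.*_) (trans (Vecₚ.lookup∘tabulate _ j) (length-filterᵇ (λ S → lookup S j) t))) ⟩
    Sumℕ.∑ (allFin n) (λ j → toℕ j ℕ.* Sumℕ.∑ t (λ S → Sumℕ.⟦ lookup S j ⟧))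
      ≡⟨ Sumℕ.∑-cong (allFin n) (λ j → Sumℕ.∑-*ˡ t (toℕ j) _) ⟨
    Sumℕ.∑ (allFin n) (λ j → Sumℕ.∑ t (λ S → toℕ j ℕ.* Sumℕ.⟦ lookup S j ⟧))
      ≡⟨ Sumℕ.∑-swap (allFin n) t _ ⟩
    Sumℕ.∑ t (total 0) ∎

  -- An exponent in e_λ counts the factors whose subset contains a given index, so it is at most the
  -- number of parts; hence the bound on `B`.
  ∑-coeffE : ∀ B ps τ → length ps < B → ∑ (box B n) (λ α → τ (weight α) * + coeffE ps α) ≡ ev ps τ
  ∑-coeffE B ps τ len<B = begin
    ∑ (box B n) (λ α → τ (weight α) * + coeffE ps α)
      ≡⟨ ∑-cong (box B n) (λ α → cong (τ (weight α) *_) (trans (+length-filterᵇ _ (eTuples n ps))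
           (∑-cong (eTuples n ps) (λ t → sym (ℤₚ.*-identityˡ _))))) ⟩
    ∑ (box B n) (λ α → τ (weight α) * ∑ (eTuples n ps) (λ t → 1ℤ * ⟦ allᵇ (λ j → multiplicity j t ≡ᵇ lookup α j) (allFin n) ⟧))
      ≡⟨ ∑-by-content B n (eTuples n ps) (λ _ → 1ℤ) (λ t j → multiplicity j t)
           (All.map (λ {t} e j → ℕₚ.≤-<-trans (Listₚ.length-filter _ t) (subst (_< B) (sym e) len<B)) (length-eTuples ps)) (τ ∘ weight) ⟩
    ∑ (eTuples n ps) (λ t → 1ℤ * τ (weight (Vec.tabulate (λ j → multiplicity j t))))
      ≡⟨ ∑-cong (eTuples n ps) (λ t → trans (ℤₚ.*-identityˡ _) (cong τ (weight-multiplicity t))) ⟩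
    ∑ (eTuples n ps) (λ t → τ (Sumℕ.∑ t (total 0)))
      ≡⟨ ∑-eTuples ps τ ⟩
    ev ps τ ∎

-- Paths

_≠ᵇ_ : ∀ {q} → Fin q → Fin q → Bool
a ≠ᵇ b = not (finEq a b)

pathᵇ : ∀ {q m} → Fin q → Vec (Fin q) m → Fin q → Bool
pathᵇ a []       b = a ≠ᵇ b
pathᵇ a (x ∷ xs) b = (a ≠ᵇ x) ∧ pathᵇ x xs b

colourSum : ∀ {q m} → Vec (Fin q) m → ℕ
colourSum []       = 0
colourSum (x ∷ xs) = toℕ x ℕ.+ colourSum xs

⟦not⟧ : ∀ b → ⟦ not b ⟧ ≡ 1ℤ - ⟦ b ⟧
⟦not⟧ true  = refl
⟦not⟧ false = refl

finEq-refl : ∀ {q} (i : Fin q) → finEq i i ≡ true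
finEq-refl i = ≡ᵇ-complete {toℕ i} refl

finEq-sound : ∀ {q} (i j : Fin q) → finEq i j ≡ true → i ≡ j
finEq-sound i j e = Finₚ.toℕ-injective (≡ᵇ-sound (toℕ i) (toℕ j) e)

finEq-sym : ∀ {q} (i j : Fin q) → finEq i j ≡ finEq j i
finEq-sym i j = Boolₚ.⇔→≡ {z = true} (mk⇔ (λ e → subst (λ k → finEq k i ≡ true) (finEq-sound i j e) (finEq-refl i))
                                       (λ e → subst (λ k → finEq k j ≡ true) (finEq-sound j i e) (finEq-refl j)))

module Walk (n : ℕ) (0<n : 0 < n) where

  walk : (m : ℕ) → Fin n → Fin n → (ℕ → ℤ) → ℤ
  walk m i j F = ∑ (vecs (allFin n) m) (λ xs → ⟦ pathᵇ i xs j ⟧ * F (toℕ i ℕ.+ (colourSum xs ℕ.+ toℕ j)))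

  -- Deletion and contraction of the first edge: drop the condition `i ≠ᵇ x`, then subtract the
  -- colourings with x = i. In both terms the colour `i` of the first vertex remains as a
  -- translation.
  walk-suc : ∀ m i j F → walk (suc m) i j F ≡
             ∑ (allFin n) (λ x → walk m x j (λ s → F (toℕ i ℕ.+ s))) - walk m i j (λ s → F (toℕ i ℕ.+ s))
  walk-suc m i j F = begin
    walk (suc m) i j F
      ≡⟨ ∑-vecs (allFin n) m (λ xs → ⟦ pathᵇ i xs j ⟧ * F (toℕ i ℕ.+ (colourSum xs ℕ.+ toℕ j))) ⟩
    ∑ (allFin n) (λ x → ∑ (vecs (allFin n) m) (λ xs → ⟦ (i ≠ᵇ x) ∧ pathᵇ x xs j ⟧ * F (toℕ i ℕ.+ (toℕ x ℕ.+ colourSum xs ℕ.+ toℕ j))))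
      ≡⟨ ∑-cong (allFin n) (λ x → trans (∑-cong (vecs (allFin n) m) (first-step x))
           (∑-*ˡ (vecs (allFin n) m) ⟦ i ≠ᵇ x ⟧ (λ xs → ⟦ pathᵇ x xs j ⟧ * G (toℕ x ℕ.+ (colourSum xs ℕ.+ toℕ j))))) ⟩
    ∑ (allFin n) (λ x → ⟦ i ≠ᵇ x ⟧ * walk m x j G)
      ≡⟨ ∑-cong (allFin n) (λ x → trans (cong (_* walk m x j G) (⟦not⟧ (finEq i x))) (expand ⟦ finEq i x ⟧ (walk m x j G))) ⟩
    ∑ (allFin n) (λ x → walk m x j G - ⟦ finEq i x ⟧ * walk m x j G)
      ≡⟨ ∑-- (allFin n) (λ x → walk m x j G) (λ x → ⟦ finEq i x ⟧ * walk m x j G) ⟩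
    ∑ (allFin n) (λ x → walk m x j G) - ∑ (allFin n) (λ x → ⟦ finEq i x ⟧ * walk m x j G)
      ≡⟨ cong (_-_ (∑ (allFin n) (λ x → walk m x j G))) (∑-pick i (λ x → walk m x j G)) ⟩
    ∑ (allFin n) (λ x → walk m x j G) - walk m i j G ∎
    where
    G : ℕ → ℤ
    G s = F (toℕ i ℕ.+ s)
    expand : ∀ d w → (1ℤ - d) * w ≡ w - d * w
    expand = solveℤ
    first-step : ∀ x xs → ⟦ (i ≠ᵇ x) ∧ pathᵇ x xs j ⟧ * F (toℕ i ℕ.+ (toℕ x ℕ.+ colourSum xs ℕ.+ toℕ j)) ≡
                          ⟦ i ≠ᵇ x ⟧ * (⟦ pathᵇ x xs j ⟧ * G (toℕ x ℕ.+ (colourSum xs ℕ.+ toℕ j)))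
    first-step x xs = trans (cong₂ _*_ (⟦⟧-∧ (i ≠ᵇ x) (pathᵇ x xs j)) (cong G (ℕₚ.+-assoc (toℕ x) _ _)))
                            (ℤₚ.*-assoc ⟦ i ≠ᵇ x ⟧ ⟦ pathᵇ x xs j ⟧ _)

  -- All terms ζ^{ai+bj} with a, b ≥ 1 and a + b = k + 1, that is, ζ^{i+j} times the complete
  -- homogeneous polynomial of degree k - 1 in ζⁱ, ζʲ (for k ≥ 1).
  mixed : ℕ → Fin n → Fin n → (ℕ → ℤ) → ℤ
  mixed k i j F = ∑ (allFin k) (λ r → F (suc (toℕ r) ℕ.* toℕ i ℕ.+ (k ∸ toℕ r) ℕ.* toℕ j))

  sign : ℕ → ℤ
  sign zero    = 1ℤ
  sign (suc m) = - sign m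

  sign² : ∀ m → sign m * sign m ≡ 1ℤ
  sign² zero    = refl
  sign² (suc m) = trans (neg² (sign m)) (sign² m)
    where
    neg² : ∀ x → (- x) * (- x) ≡ x * x
    neg² = solveℤ

  -- The colour `x` enters each term with a factor between 1 and k < n, which n does not divide, so
  -- summing over `x` gives 0.
  ∑-mixed : ∀ k → k < n → ∀ j {F} → Cyclotomic n F → ∀ a → ∑ (allFin n) (λ x → mixed k x j (λ s → F (a ℕ.+ s))) ≡ 0ℤ
  ∑-mixed k k<n j {F} cyc a = begin
    ∑ (allFin n) (λ x → ∑ (allFin k) (λ r → F (a ℕ.+ (suc (toℕ r) ℕ.* toℕ x ℕ.+ (k ∸ toℕ r) ℕ.* toℕ j))))
      ≡⟨ ∑-swap (allFin n) (allFin k) (λ x r → F (a ℕ.+ (suc (toℕ r) ℕ.* toℕ x ℕ.+ (k ∸ toℕ r) ℕ.* toℕ j))) ⟩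
    ∑ (allFin k) (λ r → ∑ (allFin n) (λ x → F (a ℕ.+ (suc (toℕ r) ℕ.* toℕ x ℕ.+ (k ∸ toℕ r) ℕ.* toℕ j))))
      ≡⟨ ∑-zero (allFin k) (λ r → trans (∑-cong (allFin n) (λ x → cong F (arith a (suc (toℕ r)) (toℕ x) ((k ∸ toℕ r) ℕ.* toℕ j))))
           (Cyclotomic.balanced cyc (a ℕ.+ (k ∸ toℕ r) ℕ.* toℕ j) (suc (toℕ r))
             (>⇒∤ (ℕₚ.≤-<-trans (Finₚ.toℕ<n r) k<n)))) ⟩
    0ℤ ∎
    where
    arith : ∀ a r x c → a ℕ.+ (r ℕ.* x ℕ.+ c) ≡ a ℕ.+ c ℕ.+ x ℕ.* r
    arith = solve-∀

  -- Apply `walk-suc`. In the sum over all second colours the mixed terms cancel by `∑-mixed`, and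
  -- only the diagonal is left. It supplies, up to sign, exactly the term with a = 1 by which the
  -- next `mixed` is longer than the translated previous one.
  walk-mixed : ∀ m → m < n → ∀ i j {F} → Cyclotomic n F →
    walk m i j F ≡ sign m * (mixed (suc m) i j F - ⟦ finEq i j ⟧ * F (suc (suc m) ℕ.* toℕ i))
  walk-mixed zero _ i j {F} _ = begin
    ⟦ i ≠ᵇ j ⟧ * F (toℕ i ℕ.+ toℕ j) + 0ℤ
      ≡⟨ cong (λ x → x * F (toℕ i ℕ.+ toℕ j) + 0ℤ) (⟦not⟧ (finEq i j)) ⟩
    (1ℤ - ⟦ finEq i j ⟧) * F (toℕ i ℕ.+ toℕ j) + 0ℤ
      ≡⟨ expand ⟦ finEq i j ⟧ (F (toℕ i ℕ.+ toℕ j)) ⟩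
    1ℤ * (F (toℕ i ℕ.+ toℕ j) + 0ℤ - ⟦ finEq i j ⟧ * F (toℕ i ℕ.+ toℕ j))
      ≡⟨ cong₂ (λ x y → 1ℤ * (x + 0ℤ - y)) (cong F (sym (cong₂ ℕ._+_ (ℕₚ.*-identityˡ (toℕ i)) (ℕₚ.*-identityˡ (toℕ j))))) (on-diagonal (finEq i j) refl) ⟩
    1ℤ * (mixed 1 i j F - ⟦ finEq i j ⟧ * F (2 ℕ.* toℕ i)) ∎
    where
    expand : ∀ d x → (1ℤ - d) * x + 0ℤ ≡ 1ℤ * (x + 0ℤ - d * x)
    expand = solveℤ
    on-diagonal : ∀ b → finEq i j ≡ b → ⟦ b ⟧ * F (toℕ i ℕ.+ toℕ j) ≡ ⟦ b ⟧ * F (2 ℕ.* toℕ i)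
    on-diagonal true  e = cong (λ x → 1ℤ * F x) (cong (toℕ i ℕ.+_) (trans (cong toℕ (sym (finEq-sound i j e))) (sym (ℕₚ.+-identityʳ (toℕ i)))))
    on-diagonal false e = trans (ℤₚ.*-zeroˡ (F (toℕ i ℕ.+ toℕ j))) (sym (ℤₚ.*-zeroˡ (F (2 ℕ.* toℕ i))))
  walk-mixed (suc m) sm<n i j {F} cyc = begin
    walk (suc m) i j F
      ≡⟨ walk-suc m i j F ⟩
    ∑ (allFin n) (λ x → walk m x j G) - walk m i j G
      ≡⟨ cong₂ _-_ all-starts (walk-mixed m m<n i j (cyclotomic-translate cyc (toℕ i))) ⟩
    sign m * (0ℤ - G (k ℕ.* toℕ j)) - sign m * (mixed (suc m) i j G - ⟦ finEq i j ⟧ * G (k ℕ.* toℕ i))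
      ≡⟨ regroup (sign m) (G (k ℕ.* toℕ j)) (mixed (suc m) i j G) (⟦ finEq i j ⟧ * G (k ℕ.* toℕ i)) ⟩
    (- sign m) * ((G (k ℕ.* toℕ j) + mixed (suc m) i j G) - ⟦ finEq i j ⟧ * G (k ℕ.* toℕ i))
      ≡⟨ cong (λ x → (- sign m) * (x - ⟦ finEq i j ⟧ * F (suc k ℕ.* toℕ i))) mixed-suc ⟨
    sign (suc m) * (mixed (suc (suc m)) i j F - ⟦ finEq i j ⟧ * F (suc (suc (suc m)) ℕ.* toℕ i)) ∎
    where
    k : ℕ
    k = suc (suc m)
    G : ℕ → ℤ
    G s = F (toℕ i ℕ.+ s)
    m<n : m < n
    m<n = ℕₚ.<-trans (ℕₚ.n<1+n m) sm<n
    regroup : ∀ s g r d → s * (0ℤ - g) - s * (r - d) ≡ (- s) * ((g + r) - d)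
    regroup = solveℤ
    diagonal : ∑ (allFin n) (λ x → ⟦ finEq x j ⟧ * G (k ℕ.* toℕ x)) ≡ G (k ℕ.* toℕ j)
    diagonal = trans (∑-cong (allFin n) (λ x → cong (λ b → ⟦ b ⟧ * G (k ℕ.* toℕ x)) (finEq-sym x j))) (∑-pick j (λ x → G (k ℕ.* toℕ x)))
    all-starts : ∑ (allFin n) (λ x → walk m x j G) ≡ sign m * (0ℤ - G (k ℕ.* toℕ j))
    all-starts = begin
      ∑ (allFin n) (λ x → walk m x j G)
        ≡⟨ ∑-cong (allFin n) (λ x → walk-mixed m m<n x j (cyclotomic-translate cyc (toℕ i))) ⟩
      ∑ (allFin n) (λ x → sign m * (mixed (suc m) x j G - ⟦ finEq x j ⟧ * G (k ℕ.* toℕ x)))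
        ≡⟨ ∑-*ˡ (allFin n) (sign m) (λ x → mixed (suc m) x j G - ⟦ finEq x j ⟧ * G (k ℕ.* toℕ x)) ⟩
      sign m * ∑ (allFin n) (λ x → mixed (suc m) x j G - ⟦ finEq x j ⟧ * G (k ℕ.* toℕ x))
        ≡⟨ cong (sign m *_) (∑-- (allFin n) (λ x → mixed (suc m) x j G) (λ x → ⟦ finEq x j ⟧ * G (k ℕ.* toℕ x))) ⟩
      sign m * (∑ (allFin n) (λ x → mixed (suc m) x j G) - ∑ (allFin n) (λ x → ⟦ finEq x j ⟧ * G (k ℕ.* toℕ x)))
        ≡⟨ cong (sign m *_) (cong₂ _-_ (∑-mixed (suc m) sm<n j cyc (toℕ i)) diagonal) ⟩
      sign m * (0ℤ - G (k ℕ.* toℕ j)) ∎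
    mixed-suc : mixed (suc (suc m)) i j F ≡ G (k ℕ.* toℕ j) + mixed (suc m) i j G
    mixed-suc = trans (∑-allFin (suc m) (λ r → F (suc (toℕ r) ℕ.* toℕ i ℕ.+ (k ∸ toℕ r) ℕ.* toℕ j)))
      (cong₂ _+_ (cong (λ x → F (x ℕ.+ k ℕ.* toℕ j)) (ℕₚ.*-identityˡ (toℕ i)))
                 (∑-cong (allFin (suc m)) (λ r → cong F (ℕₚ.+-assoc (toℕ i) (suc (toℕ r) ℕ.* toℕ i) _))))

  -- The number (n ∸ 1) b stands for -b modulo n.
  residue-unique : ∀ {a b} → a < n → b < n → n ∣ a ℕ.+ (n ∸ 1) ℕ.* b → a ≡ b
  residue-unique {a} {b} a<n b<n (divides c e) = begin
    a                    ≡⟨ m<n⇒m%n≡m a<n ⟨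
    a % n                ≡⟨ [m+kn]%n≡m%n a b n ⟨
    (a ℕ.+ b ℕ.* n) % n  ≡⟨ cong (_% n) shifted ⟩
    (b ℕ.+ c ℕ.* n) % n  ≡⟨ [m+kn]%n≡m%n b c n ⟩
    b % n                ≡⟨ m<n⇒m%n≡m b<n ⟩
    b                    ∎
    where
    instance
      n≢0 : NonZero n
      n≢0 = ℕ.>-nonZero 0<n
    arith : ∀ a b k → a ℕ.+ b ℕ.* suc k ≡ b ℕ.+ (a ℕ.+ k ℕ.* b)
    arith = solve-∀
    shifted : a ℕ.+ b ℕ.* n ≡ b ℕ.+ c ℕ.* n
    shifted = begin
      a ℕ.+ b ℕ.* n                  ≡⟨ cong (λ x → a ℕ.+ b ℕ.* x) (ℕₚ.suc-pred n) ⟨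
      a ℕ.+ b ℕ.* suc (ℕ.pred n)     ≡⟨ arith a b (ℕ.pred n) ⟩
      b ℕ.+ (a ℕ.+ ℕ.pred n ℕ.* b)   ≡⟨⟩
      b ℕ.+ (a ℕ.+ (n ∸ 1) ℕ.* b)    ≡⟨ cong (b ℕ.+_) e ⟩
      b ℕ.+ c ℕ.* n                  ∎

  -- Since ζⁿ = 1, this is the geometric series of ζ^{i-j} over a full period: n if i = j and 0
  -- otherwise.
  ∑-homogeneous : ∀ i j {F} → Cyclotomic n F →
    ∑ (allFin n) (λ r → F (toℕ r ℕ.* toℕ i ℕ.+ (n ∸ toℕ r) ℕ.* toℕ j)) ≡ + n * (⟦ finEq i j ⟧ * F 0)
  ∑-homogeneous i j {F} cyc with finEq i j in eq
  ... | true  = begin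
    ∑ (allFin n) (λ r → F (toℕ r ℕ.* toℕ i ℕ.+ (n ∸ toℕ r) ℕ.* toℕ j))
      ≡⟨ ∑-cong (allFin n) (λ r → trans (cong F (trans (cong (λ x → toℕ r ℕ.* toℕ x ℕ.+ (n ∸ toℕ r) ℕ.* toℕ j) (finEq-sound i j eq)) (multiple r)))
                                        (period-* (Cyclotomic.periodic cyc) (toℕ j) 0)) ⟩
    ∑ (allFin n) (λ r → F 0)
      ≡⟨ ∑-const n (F 0) ⟩
    + n * F 0
      ≡⟨ cong (+ n *_) (ℤₚ.*-identityˡ (F 0)) ⟨
    + n * (1ℤ * F 0) ∎
    where
    multiple : ∀ (r : Fin n) → toℕ r ℕ.* toℕ j ℕ.+ (n ∸ toℕ r) ℕ.* toℕ j ≡ toℕ j ℕ.* n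
    multiple r = trans (sym (ℕₚ.*-distribʳ-+ (toℕ j) (toℕ r) _))
      (trans (cong (ℕ._* toℕ j) (ℕₚ.m+[n∸m]≡n (ℕₚ.<⇒≤ (Finₚ.toℕ<n r)))) (ℕₚ.*-comm n (toℕ j)))
  ... | false = trans (begin
    ∑ (allFin n) (λ r → F (toℕ r ℕ.* toℕ i ℕ.+ (n ∸ toℕ r) ℕ.* toℕ j))
      ≡⟨ ∑-cong (allFin n) (λ r → begin
           F (toℕ r ℕ.* toℕ i ℕ.+ (n ∸ toℕ r) ℕ.* toℕ j)
             -- Adding r j periods avoids the negative exponent -r j: the total becomes r (i + (n -
             -- 1) j) + j n.
             ≡⟨ period-* (Cyclotomic.periodic cyc) (toℕ r ℕ.* toℕ j) _ ⟨
           F (toℕ r ℕ.* toℕ i ℕ.+ (n ∸ toℕ r) ℕ.* toℕ j ℕ.+ toℕ r ℕ.* toℕ j ℕ.* n)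
             ≡⟨ cong F (geometric r) ⟩
           F (toℕ r ℕ.* stride ℕ.+ toℕ j ℕ.* n)
             ≡⟨ period-* (Cyclotomic.periodic cyc) (toℕ j) _ ⟩
           F (toℕ r ℕ.* stride) ∎) ⟩
    ∑ (allFin n) (λ r → F (toℕ r ℕ.* stride))
      ≡⟨ Cyclotomic.balanced cyc 0 stride (i≢j ∘ residue-unique (Finₚ.toℕ<n i) (Finₚ.toℕ<n j)) ⟩
    0ℤ ∎) (sym (trans (cong (+ n *_) (ℤₚ.*-zeroˡ (F 0))) (ℤₚ.*-zeroʳ (+ n))))
    where
    instance
      n≢0 : NonZero n
      n≢0 = ℕ.>-nonZero 0<n
    stride : ℕ
    stride = toℕ i ℕ.+ (n ∸ 1) ℕ.* toℕ j
    i≢j : toℕ i ≢ toℕ j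
    i≢j e with () ← trans (sym eq) (≡ᵇ-complete e)
    arith : ∀ r i j d k → r ℕ.* i ℕ.+ d ℕ.* j ℕ.+ r ℕ.* j ℕ.* suc k ≡ r ℕ.* (i ℕ.+ k ℕ.* j) ℕ.+ j ℕ.* (r ℕ.+ d)
    arith = solve-∀
    geometric : ∀ (r : Fin n) → toℕ r ℕ.* toℕ i ℕ.+ (n ∸ toℕ r) ℕ.* toℕ j ℕ.+ toℕ r ℕ.* toℕ j ℕ.* n ≡ toℕ r ℕ.* stride ℕ.+ toℕ j ℕ.* n
    geometric r = begin
      toℕ r ℕ.* toℕ i ℕ.+ (n ∸ toℕ r) ℕ.* toℕ j ℕ.+ toℕ r ℕ.* toℕ j ℕ.* n
        ≡⟨ cong (λ x → toℕ r ℕ.* toℕ i ℕ.+ (n ∸ toℕ r) ℕ.* toℕ j ℕ.+ toℕ r ℕ.* toℕ j ℕ.* x) (ℕₚ.suc-pred n) ⟨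
      toℕ r ℕ.* toℕ i ℕ.+ (n ∸ toℕ r) ℕ.* toℕ j ℕ.+ toℕ r ℕ.* toℕ j ℕ.* suc (ℕ.pred n)
        ≡⟨ arith (toℕ r) (toℕ i) (toℕ j) (n ∸ toℕ r) (ℕ.pred n) ⟩
      toℕ r ℕ.* (toℕ i ℕ.+ ℕ.pred n ℕ.* toℕ j) ℕ.+ toℕ j ℕ.* (toℕ r ℕ.+ (n ∸ toℕ r))
        ≡⟨ cong (λ y → toℕ r ℕ.* stride ℕ.+ toℕ j ℕ.* y) (ℕₚ.m+[n∸m]≡n (ℕₚ.<⇒≤ (Finₚ.toℕ<n r))) ⟩
      toℕ r ℕ.* stride ℕ.+ toℕ j ℕ.* n ∎

-- The saltire graph

≠ᵇ-sound : ∀ {q} (a b : Fin q) → a ≠ᵇ b ≡ true → a ≢ b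
≠ᵇ-sound a b e refl with () ← trans (sym e) (cong not (finEq-refl a))

≠ᵇ-complete : ∀ {q} (a b : Fin q) → a ≢ b → a ≠ᵇ b ≡ true
≠ᵇ-complete a b a≢b with finEq a b in e
... | true  = contradiction (finEq-sound a b e) a≢b
... | false = refl

∧-intro : ∀ {a b} → a ≡ true → b ≡ true → a ∧ b ≡ true
∧-intro refl refl = refl

allᵇ-sound : ∀ {N} (p : Fin N → Bool) → allᵇ p (allFin N) ≡ true → ∀ u → p u ≡ true
allᵇ-sound {suc N} p e u with ∧-true {p zero} (trans (sym (allᵇ-allFin N p)) e)
allᵇ-sound {suc N} p e zero    | h , t = h
allᵇ-sound {suc N} p e (suc u) | h , t = allᵇ-sound (p ∘ suc) t u

allᵇ-complete : ∀ {N} (p : Fin N → Bool) → (∀ u → p u ≡ true) → allᵇ p (allFin N) ≡ true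
allᵇ-complete {zero}  p e = refl
allᵇ-complete {suc N} p e = trans (allᵇ-allFin N p) (∧-intro (e zero) (allᵇ-complete (p ∘ suc) (e ∘ suc)))

proper-sound : ∀ {N q} (G : Graph N) (κ : Vec (Fin q) N) → properᵇ G κ ≡ true →
               ∀ u v → G u v ≡ true → lookup κ u ≢ lookup κ v
proper-sound G κ e u v g with ∨-true (allᵇ-sound _ (allᵇ-sound _ e u) v)
... | inj₁ ¬g with () ← trans (sym ¬g) (cong not g)
... | inj₂ ne = ≠ᵇ-sound _ _ ne

proper-complete : ∀ {N q} (G : Graph N) (κ : Vec (Fin q) N) →
                  (∀ u v → G u v ≡ true → lookup κ u ≢ lookup κ v) → properᵇ G κ ≡ true
proper-complete G κ h = allᵇ-complete _ (λ u → allᵇ-complete _ (λ v → edge u v (G u v) refl))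
  where
  edge : ∀ u v b → G u v ≡ b → not b ∨ not (finEq (lookup κ u) (lookup κ v)) ≡ true
  edge u v false _ = refl
  edge u v true  g = ≠ᵇ-complete _ _ (h u v g)

module _ {A : Set} where

  linked-consecutive : ∀ {N} {κ : Vec A N} → Linked _≢_ κ → ∀ u v → toℕ v ≡ suc (toℕ u) → lookup κ u ≢ lookup κ v
  linked-consecutive {κ = x ∷ y ∷ κ} (r ∷ l) zero    (suc zero) e = r
  linked-consecutive {κ = x ∷ y ∷ κ} (r ∷ l) (suc u) (suc v)    e = linked-consecutive l u v (ℕₚ.suc-injective e)
  linked-consecutive {κ = x ∷ []}    [-]     zero    (suc ())   e

  consecutive-linked : ∀ {N} (κ : Vec A N) → (∀ u v → toℕ v ≡ suc (toℕ u) → lookup κ u ≢ lookup κ v) → Linked _≢_ κ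
  consecutive-linked []          h = []
  consecutive-linked (x ∷ [])    h = [-]
  consecutive-linked (x ∷ y ∷ κ) h = h zero (suc zero) refl ∷ consecutive-linked (y ∷ κ) (λ u v e → h (suc u) (suc v) (cong suc e))

  final : ∀ {m} → A → Vec A m → A
  final a []       = a
  final a (x ∷ xs) = final x xs

  final-++ : ∀ {m k} a (xs : Vec A m) b (ys : Vec A k) → final a (xs Vec.++ b ∷ ys) ≡ final b ys
  final-++ a []       b ys = refl
  final-++ a (x ∷ xs) b ys = final-++ x xs b ys

  lookup-final : ∀ {m} a (xs : Vec A m) v → toℕ v ≡ m → lookup (a ∷ xs) v ≡ final a xs
  lookup-final a []       zero    e = refl
  lookup-final a (x ∷ xs) (suc v) e = lookup-final x xs v (ℕₚ.suc-injective e)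

  lookup-shift : ∀ {m k} (xs : Vec A m) (ys : Vec A k) v w → toℕ v ≡ m ℕ.+ toℕ w → lookup (xs Vec.++ ys) v ≡ lookup ys w
  lookup-shift {m} xs ys v w e = trans (cong (lookup (xs Vec.++ ys)) (Finₚ.toℕ-injective (trans e (sym (Finₚ.toℕ-↑ʳ m w)))))
                                       (Vecₚ.lookup-++ʳ xs ys w)

path-linked : ∀ {q m k} a (xs : Vec (Fin q) m) b (ys : Vec (Fin q) k) → pathᵇ a xs b ≡ true → Linked _≢_ (b ∷ ys) →
              Linked _≢_ (a ∷ xs Vec.++ b ∷ ys)
path-linked a []       b ys e l = ≠ᵇ-sound a b e ∷ l
path-linked a (x ∷ xs) b ys e l with e₁ , e₂ ← ∧-true {a ≠ᵇ x} e = ≠ᵇ-sound a x e₁ ∷ path-linked x xs b ys e₂ l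

linked-path : ∀ {q m k} a (xs : Vec (Fin q) m) b (ys : Vec (Fin q) k) → Linked _≢_ (a ∷ xs Vec.++ b ∷ ys) →
              pathᵇ a xs b ≡ true × Linked _≢_ (b ∷ ys)
linked-path a []       b ys (r ∷ l) = ≠ᵇ-complete a b r , l
linked-path a (x ∷ xs) b ys (r ∷ l) with e , l′ ← linked-path x xs b ys l = ∧-intro (≠ᵇ-complete a x r) e , l′

path-final : ∀ {q m} a (xs : Vec (Fin q) m) b → pathᵇ a xs b ≡ true → Linked _≢_ (a ∷ xs) × final a xs ≢ b
path-final a []       b e = [-] , ≠ᵇ-sound a b e
path-final a (x ∷ xs) b e with e₁ , e₂ ← ∧-true {a ≠ᵇ x} e with l , f ← path-final x xs b e₂ = ≠ᵇ-sound a x e₁ ∷ l , f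

final-path : ∀ {q m} a (xs : Vec (Fin q) m) b → Linked _≢_ (a ∷ xs) → final a xs ≢ b → pathᵇ a xs b ≡ true
final-path a []       b l       f = ≠ᵇ-complete a b f
final-path a (x ∷ xs) b (r ∷ l) f = ∧-intro (≠ᵇ-complete a x r) (final-path x xs b l f)

differs : ∀ {q} → Fin q → Fin q → Fin q → Bool
differs i j x = (i ≠ᵇ x) ∧ (j ≠ᵇ x)

module Colouring (m : ℕ) where
  n : ℕ
  n = suc (suc m)

  -- SA_{n,n} consists of the paths c₁ xs cₙ and k ys c₀ on n vertices, and the four edges {c₁, cₙ} × {c₀, k}.
  assemble : ∀ {q} (c₀ c₁ : Fin q) (xs : Vec (Fin q) m) (cₙ k : Fin q) (ys : Vec (Fin q) m) → Vec (Fin q) (n ℕ.+ n)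
  assemble c₀ c₁ xs cₙ k ys = c₀ ∷ c₁ ∷ (xs Vec.++ (cₙ ∷ k ∷ ys))

  module _ {q} (c₀ c₁ : Fin q) (xs : Vec (Fin q) m) (cₙ k : Fin q) (ys : Vec (Fin q) m) where
    κ : Vec (Fin q) (n ℕ.+ n)
    κ = assemble c₀ c₁ xs cₙ k ys

    vₙ vₙ₊₁ : Fin (n ℕ.+ n)
    vₙ   = suc (suc (m ↑ʳ zero))
    vₙ₊₁ = suc (suc (m ↑ʳ suc zero))

    toℕ-vₙ : toℕ vₙ ≡ n
    toℕ-vₙ = cong (λ x → ℕ.suc (suc x)) (trans (Finₚ.toℕ-↑ʳ m (zero {suc m})) (ℕₚ.+-identityʳ m))

    toℕ-vₙ₊₁ : toℕ vₙ₊₁ ≡ suc n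
    toℕ-vₙ₊₁ = cong (λ x → ℕ.suc (suc x)) (trans (Finₚ.toℕ-↑ʳ m (suc {suc m} zero)) (ℕₚ.+-comm m 1))

    lookup-n : ∀ v → toℕ v ≡ n → lookup κ v ≡ cₙ
    lookup-n (suc (suc v)) e = lookup-shift xs (cₙ ∷ k ∷ ys) v zero
      (trans (ℕₚ.suc-injective (ℕₚ.suc-injective e)) (sym (ℕₚ.+-identityʳ m)))

    lookup-n+1 : ∀ v → toℕ v ≡ suc n → lookup κ v ≡ k
    lookup-n+1 (suc (suc v)) e = lookup-shift xs (cₙ ∷ k ∷ ys) v (suc zero)
      (trans (ℕₚ.suc-injective (ℕₚ.suc-injective e)) (ℕₚ.+-comm 1 m))

    lookup-last : ∀ v → toℕ v ≡ (n ℕ.+ n) ∸ 1 → lookup κ v ≡ final k ys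
    lookup-last v e = trans (lookup-final c₀ (c₁ ∷ (xs Vec.++ (cₙ ∷ k ∷ ys))) v e) (final-++ c₁ xs cₙ (k ∷ ys))

    lookup-0 : ∀ v → toℕ v ≡ 0 → lookup κ v ≡ c₀
    lookup-0 zero e = refl

    lookup-1 : ∀ v → toℕ v ≡ 1 → lookup κ v ≡ c₁
    lookup-1 (suc zero) e = refl

    -- Of the four cross edges, c₀c₁ and cₙk lie on the Hamiltonian cycle, while c₀cₙ and c₁k are
    -- the chords. The closing edge of the cycle is the last edge of the second path, which is why
    -- `c₀` is read at its end.
    split-proper : Bool
    split-proper = (differs c₁ cₙ c₀ ∧ differs c₁ cₙ k) ∧ (pathᵇ c₁ xs cₙ ∧ pathᵇ k ys c₀)

    proper⇒split : properᵇ (saltire n n) κ ≡ true → split-proper ≡ true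
    proper⇒split e with consecutive-linked κ (λ u v p → edge u v (path p))
      where
      edge : ∀ u v → SaltireEdge n (toℕ u) (toℕ v) → lookup κ u ≢ lookup κ v
      edge u v s = proper-sound (saltire n n) κ e u v (saltire-complete n u v s)
    ... | c₀≢c₁ ∷ l with p₁ , cₙ≢k ∷ l′ ← linked-path c₁ xs cₙ (k ∷ ys) l =
      ∧-intro (∧-intro (∧-intro (≠ᵇ-complete c₁ c₀ (c₀≢c₁ ∘ sym)) (≠ᵇ-complete cₙ c₀ λ cₙ≡c₀ →
                          edge zero vₙ (chord₀ refl toℕ-vₙ) (sym (trans (lookup-n vₙ toℕ-vₙ) cₙ≡c₀))))
                       (∧-intro (≠ᵇ-complete c₁ k λ c₁≡k →
                          edge (suc zero) vₙ₊₁ (chord₁ refl toℕ-vₙ₊₁) (sym (trans (lookup-n+1 vₙ₊₁ toℕ-vₙ₊₁) (sym c₁≡k))))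
                          (≠ᵇ-complete cₙ k cₙ≢k)))
              (∧-intro p₁ (final-path k ys c₀ l′ λ final≡c₀ →
                 edge zero last (close refl toℕ-last) (sym (trans (lookup-last last toℕ-last) final≡c₀))))
      where
      edge : ∀ u v → SaltireEdge n (toℕ u) (toℕ v) → lookup κ u ≢ lookup κ v
      edge u v s = proper-sound (saltire n n) κ e u v (saltire-complete n u v s)
      last : Fin (n ℕ.+ n)
      last = fromℕ ((n ℕ.+ n) ∸ 1)
      toℕ-last : toℕ last ≡ (n ℕ.+ n) ∸ 1
      toℕ-last = Finₚ.toℕ-fromℕ _

    split⇒proper : split-proper ≡ true → properᵇ (saltire n n) κ ≡ true
    split⇒proper e
      with cross , paths ← ∧-true {differs c₁ cₙ c₀ ∧ differs c₁ cₙ k} e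
      with at-c₀ , at-k ← ∧-true {differs c₁ cₙ c₀} cross | p₁ , p₂ ← ∧-true {pathᵇ c₁ xs cₙ} paths
      with c₁c₀ , cₙc₀ ← ∧-true {c₁ ≠ᵇ c₀} at-c₀ | c₁k , cₙk ← ∧-true {c₁ ≠ᵇ k} at-k
      with l′ , final≢c₀ ← path-final k ys c₀ p₂ =
      proper-complete (saltire n n) κ λ u v g → [ edge u v , (λ s → edge v u s ∘ sym) ]′ (saltire-sound n u v g)
      where
      linked : Linked _≢_ κ
      linked = (≠ᵇ-sound c₁ c₀ c₁c₀ ∘ sym) ∷ path-linked c₁ xs cₙ (k ∷ ys) p₁ (≠ᵇ-sound cₙ k cₙk ∷ l′)
      edge : ∀ u v → SaltireEdge n (toℕ u) (toℕ v) → lookup κ u ≢ lookup κ v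
      edge u v (path p)     eq = linked-consecutive linked u v p eq
      edge u v (close p q)  eq = final≢c₀ (trans (sym (lookup-last v q)) (trans (sym eq) (lookup-0 u p)))
      edge u v (chord₀ p q) eq = ≠ᵇ-sound cₙ c₀ cₙc₀ (trans (sym (lookup-n v q)) (trans (sym eq) (lookup-0 u p)))
      edge u v (chord₁ p q) eq = ≠ᵇ-sound c₁ k c₁k (trans (sym (lookup-1 u p)) (trans eq (lookup-n+1 v q)))

    proper≡split : properᵇ (saltire n n) κ ≡ split-proper
    proper≡split = Boolₚ.⇔→≡ {z = true} (mk⇔ proper⇒split split⇒proper)

    colourSum-assemble : colourSum κ ≡ (toℕ c₁ ℕ.+ (colourSum xs ℕ.+ toℕ cₙ)) ℕ.+ (toℕ k ℕ.+ (colourSum ys ℕ.+ toℕ c₀))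
    colourSum-assemble = trans (cong (λ s → toℕ c₀ ℕ.+ (toℕ c₁ ℕ.+ s)) (colourSum-++ xs (cₙ ∷ k ∷ ys)))
                               (arith (toℕ c₀) (toℕ c₁) (colourSum xs) (toℕ cₙ) (toℕ k) (colourSum ys))
      where
      colourSum-++ : ∀ {a b} (xs : Vec (Fin q) a) (ys : Vec (Fin q) b) → colourSum (xs Vec.++ ys) ≡ colourSum xs ℕ.+ colourSum ys
      colourSum-++ []       ys = refl
      colourSum-++ (x ∷ xs) ys = trans (cong (toℕ x ℕ.+_) (colourSum-++ xs ys)) (sym (ℕₚ.+-assoc (toℕ x) _ _))
      arith : ∀ a b x c d y → a ℕ.+ (b ℕ.+ (x ℕ.+ (c ℕ.+ (d ℕ.+ y)))) ≡ (b ℕ.+ (x ℕ.+ c)) ℕ.+ (d ℕ.+ (y ℕ.+ a))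
      arith = solve-∀

-- From monomial coefficients of X to sums over proper colourings

∑ℕ-pick : ∀ {n} (i : Fin n) (g : Fin n → ℕ) → Sumℕ.∑ (allFin n) (λ j → g j ℕ.* Sumℕ.⟦ finEq i j ⟧) ≡ g i
∑ℕ-pick {n} i g = ℤₚ.+-injective (begin
  + Sumℕ.∑ (allFin n) (λ j → g j ℕ.* Sumℕ.⟦ finEq i j ⟧)   ≡⟨ ∑-pos (allFin n) (λ j → g j ℕ.* Sumℕ.⟦ finEq i j ⟧) ⟩
  ∑ (allFin n) (λ j → + (g j ℕ.* Sumℕ.⟦ finEq i j ⟧))   ≡⟨ ∑-cong (allFin n) (λ j → trans (ℤₚ.pos-* (g j) Sumℕ.⟦ finEq i j ⟧)
                                                          (trans (ℤₚ.*-comm (+ g j) (+ Sumℕ.⟦ finEq i j ⟧)) (cong (_* + g j) (pos-⟦⟧ (finEq i j))))) ⟩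
  ∑ (allFin n) (λ j → ⟦ finEq i j ⟧ * + g j)         ≡⟨ ∑-pick i (λ j → + g j) ⟩
  + g i                                              ∎)

weight-classSize : ∀ {M n} (κ : Vec (Fin n) M) → weight (Vec.tabulate (classSize κ)) ≡ colourSum κ
weight-classSize {M} {n} κ = begin
  Sumℕ.∑ (allFin n) (λ j → toℕ j ℕ.* lookup (Vec.tabulate (classSize κ)) j)
    ≡⟨ Sumℕ.∑-cong (allFin n) (λ j → cong (toℕ j ℕ.*_) (trans (Vecₚ.lookup∘tabulate (classSize κ) j)
         (length-filterᵇ (λ u → finEq (lookup κ u) j) (allFin M)))) ⟩
  Sumℕ.∑ (allFin n) (λ j → toℕ j ℕ.* Sumℕ.∑ (allFin M) (λ u → Sumℕ.⟦ finEq (lookup κ u) j ⟧))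
    ≡⟨ Sumℕ.∑-cong (allFin n) (λ j → Sumℕ.∑-*ˡ (allFin M) (toℕ j) (λ u → Sumℕ.⟦ finEq (lookup κ u) j ⟧)) ⟨
  Sumℕ.∑ (allFin n) (λ j → Sumℕ.∑ (allFin M) (λ u → toℕ j ℕ.* Sumℕ.⟦ finEq (lookup κ u) j ⟧))
    ≡⟨ Sumℕ.∑-swap (allFin n) (allFin M) (λ j u → toℕ j ℕ.* Sumℕ.⟦ finEq (lookup κ u) j ⟧) ⟩
  Sumℕ.∑ (allFin M) (λ u → Sumℕ.∑ (allFin n) (λ j → toℕ j ℕ.* Sumℕ.⟦ finEq (lookup κ u) j ⟧))
    ≡⟨ Sumℕ.∑-cong (allFin M) (λ u → ∑ℕ-pick (lookup κ u) toℕ) ⟩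
  Sumℕ.∑ (allFin M) (λ u → toℕ (lookup κ u))
    ≡⟨ sum-lookup κ ⟩
  colourSum κ ∎
  where
  sum-lookup : ∀ {M} (κ : Vec (Fin n) M) → Sumℕ.∑ (allFin M) (λ u → toℕ (lookup κ u)) ≡ colourSum κ
  sum-lookup []                = refl
  sum-lookup {suc M} (x ∷ κ)   = trans (Sumℕ.∑-allFin M (λ u → toℕ (lookup (x ∷ κ) u))) (cong (toℕ x ℕ.+_) (sum-lookup κ))

∑-coeffX : ∀ {M} n (G : Graph M) B τ → M < B →
  ∑ (box B n) (λ α → τ (weight α) * + coeffX G α) ≡ ∑ (vecs (allFin n) M) (λ κ → ⟦ properᵇ G κ ⟧ * τ (colourSum κ))
∑-coeffX {M} n G B τ M<B = begin
  ∑ (box B n) (λ α → τ (weight α) * + coeffX G α)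
    ≡⟨ ∑-cong (box B n) (λ α → cong (τ (weight α) *_) (trans (+length-filterᵇ _ (vecs (allFin n) M))
         (∑-cong (vecs (allFin n) M) (λ κ → ⟦⟧-∧ (properᵇ G κ) (hasTypeᵇ α κ))))) ⟩
  ∑ (box B n) (λ α → τ (weight α) * ∑ (vecs (allFin n) M) (λ κ → ⟦ properᵇ G κ ⟧ * ⟦ hasTypeᵇ α κ ⟧))
    ≡⟨ ∑-by-content B n (vecs (allFin n) M) (λ κ → ⟦ properᵇ G κ ⟧) classSize
         (All.universal (λ κ j → ℕₚ.≤-<-trans (Listₚ.length-filter _ (allFin M)) (subst (_< B) (sym (Listₚ.length-tabulate id)) M<B)) _)
         (τ ∘ weight) ⟩
  ∑ (vecs (allFin n) M) (λ κ → ⟦ properᵇ G κ ⟧ * τ (weight (Vec.tabulate (classSize κ))))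
    ≡⟨ ∑-cong (vecs (allFin n) M) (λ κ → cong (λ w → ⟦ properᵇ G κ ⟧ * τ w) (weight-classSize κ)) ⟩
  ∑ (vecs (allFin n) M) (λ κ → ⟦ properᵇ G κ ⟧ * τ (colourSum κ)) ∎

-- The value of X for the saltire graph at the roots of unity

module Evaluation (m : ℕ) where
  open Colouring m
  open Walk (suc (suc m)) (s≤s z≤n)

  private
    N : ℤ
    N = + n
    colours : List (Fin n)
    colours = allFin n
    paths : List (Vec (Fin n) m)
    paths = vecs colours m

  coupling : Fin n → Fin n → ℤ
  coupling i j = N * ⟦ finEq i j ⟧ - 1ℤ - ⟦ finEq i j ⟧

  -- With m = n - 2 inner vertices all terms have degree n. Then `mixed` is the full sum of
  -- `∑-homogeneous` without its term r = 0, which is ζ^{nj} = 1. The result is an integer multiple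
  -- of `F 0`, so the two paths can be evaluated one after the other.
  walk-coupling : ∀ i j {F} → Cyclotomic n F → walk m i j F ≡ sign m * (coupling i j * F 0)
  walk-coupling i j {F} cyc = begin
    walk m i j F
      ≡⟨ walk-mixed m (ℕₚ.m<n⇒m<1+n (ℕₚ.n<1+n m)) i j cyc ⟩
    sign m * (mixed (suc m) i j F - ⟦ finEq i j ⟧ * F (n ℕ.* toℕ i))
      ≡⟨ cong₂ (λ x y → sign m * (x - ⟦ finEq i j ⟧ * y)) mixed≡ (multiple i) ⟩
    sign m * (N * (⟦ finEq i j ⟧ * F 0) - F 0 - ⟦ finEq i j ⟧ * F 0)
      ≡⟨ cong (sign m *_) (factor N ⟦ finEq i j ⟧ (F 0)) ⟩
    sign m * (coupling i j * F 0) ∎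
    where
    factor : ∀ N d x → N * (d * x) - x - d * x ≡ (N * d - 1ℤ - d) * x
    factor = solveℤ
    multiple : ∀ j → F (n ℕ.* toℕ j) ≡ F 0
    multiple j = trans (cong F (ℕₚ.*-comm n (toℕ j))) (period-* (Cyclotomic.periodic cyc) (toℕ j) 0)
    cancel : ∀ x y → x ≡ (y + x) - y
    cancel = solveℤ
    mixed≡ : mixed (suc m) i j F ≡ N * (⟦ finEq i j ⟧ * F 0) - F 0
    mixed≡ = begin
      mixed (suc m) i j F
        ≡⟨ cancel (mixed (suc m) i j F) (F (n ℕ.* toℕ j)) ⟩
      (F (n ℕ.* toℕ j) + mixed (suc m) i j F) - F (n ℕ.* toℕ j)
        ≡⟨ cong (_- F (n ℕ.* toℕ j)) (∑-allFin (suc m) (λ r → F (toℕ r ℕ.* toℕ i ℕ.+ (n ∸ toℕ r) ℕ.* toℕ j))) ⟨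
      ∑ colours (λ r → F (toℕ r ℕ.* toℕ i ℕ.+ (n ∸ toℕ r) ℕ.* toℕ j)) - F (n ℕ.* toℕ j)
        ≡⟨ cong₂ _-_ (∑-homogeneous i j cyc) (multiple j) ⟩
      N * (⟦ finEq i j ⟧ * F 0) - F 0 ∎

  ∑-finEq : ∀ (i : Fin n) → ∑ colours (λ x → ⟦ finEq i x ⟧) ≡ 1ℤ
  ∑-finEq i = trans (∑-cong colours (λ x → sym (ℤₚ.*-identityʳ ⟦ finEq i x ⟧))) (∑-pick i (λ _ → 1ℤ))

  ∑-one : ∑ colours (λ _ → 1ℤ) ≡ N
  ∑-one = trans (∑-const n 1ℤ) (ℤₚ.*-identityʳ N)

  free : Fin n → Fin n → ℤ
  free i j = N - + 2 + ⟦ finEq i j ⟧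

  ∑-differs : ∀ i j → ∑ colours (λ x → ⟦ differs i j x ⟧) ≡ free i j
  ∑-differs i j = begin
    ∑ colours (λ x → ⟦ differs i j x ⟧)
      ≡⟨ ∑-cong colours (λ x → trans (⟦⟧-∧ (i ≠ᵇ x) (j ≠ᵇ x)) (trans (cong₂ _*_ (⟦not⟧ (finEq i x)) (⟦not⟧ (finEq j x)))
                                                                  (expand ⟦ finEq i x ⟧ ⟦ finEq j x ⟧))) ⟩
    ∑ colours (λ x → 1ℤ - ⟦ finEq i x ⟧ - ⟦ finEq j x ⟧ * (1ℤ - ⟦ finEq i x ⟧))
      ≡⟨ ∑-- colours (λ x → 1ℤ - ⟦ finEq i x ⟧) (λ x → ⟦ finEq j x ⟧ * (1ℤ - ⟦ finEq i x ⟧)) ⟩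
    ∑ colours (λ x → 1ℤ - ⟦ finEq i x ⟧) - ∑ colours (λ x → ⟦ finEq j x ⟧ * (1ℤ - ⟦ finEq i x ⟧))
      ≡⟨ cong₂ _-_ (trans (∑-- colours (λ _ → 1ℤ) (λ x → ⟦ finEq i x ⟧)) (cong₂ _-_ ∑-one (∑-finEq i)))
                   (∑-pick j (λ x → 1ℤ - ⟦ finEq i x ⟧)) ⟩
    N - 1ℤ - (1ℤ - ⟦ finEq i j ⟧)
      ≡⟨ regroup N ⟦ finEq i j ⟧ ⟩
    free i j ∎
    where
    expand : ∀ a b → (1ℤ - a) * (1ℤ - b) ≡ 1ℤ - a - b * (1ℤ - a)
    expand = solveℤ
    regroup : ∀ N d → N - 1ℤ - (1ℤ - d) ≡ N - + 2 + d
    regroup = solveℤ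

  ⟦⟧-idem : ∀ b → ⟦ b ⟧ * ⟦ b ⟧ ≡ ⟦ b ⟧
  ⟦⟧-idem true  = refl
  ⟦⟧-idem false = refl

  -- As `coupling` is (n - 1) δ - 1, each admissible colour contributes n - 1 on the diagonal and
  -- each ordered pair of admissible colours contributes -1.
  ∑-coupling : ∀ i j → ∑ colours (λ x → ∑ colours (λ y → ⟦ differs i j x ⟧ * ⟦ differs i j y ⟧ * coupling y x)) ≡
               (N - 1ℤ) * free i j - free i j * free i j
  ∑-coupling i j = begin
    ∑ colours (λ x → ∑ colours (λ y → d x * d y * coupling y x))
      ≡⟨ ∑-cong colours (λ x → trans (∑-cong colours (expand x)) (trans (∑-*ˡ colours (d x) (inner x)) (cong (d x *_) (sum-inner x)))) ⟩
    ∑ colours (λ x → d x * ((N - 1ℤ) * d x - free i j))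
      ≡⟨ ∑-cong colours (λ x → trans (distribute (d x) (N - 1ℤ) (free i j)) (cong (λ s → (N - 1ℤ) * s - free i j * d x) (⟦⟧-idem (differs i j x)))) ⟩
    ∑ colours (λ x → (N - 1ℤ) * d x - free i j * d x)
      ≡⟨ ∑-- colours (λ x → (N - 1ℤ) * d x) (λ x → free i j * d x) ⟩
    ∑ colours (λ x → (N - 1ℤ) * d x) - ∑ colours (λ x → free i j * d x)
      ≡⟨ cong₂ _-_ (trans (∑-*ˡ colours (N - 1ℤ) d) (cong ((N - 1ℤ) *_) (∑-differs i j)))
                   (trans (∑-*ˡ colours (free i j) d) (cong (free i j *_) (∑-differs i j))) ⟩
    (N - 1ℤ) * free i j - free i j * free i j ∎
    where
    d : Fin n → ℤ
    d x = ⟦ differs i j x ⟧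
    inner : Fin n → Fin n → ℤ
    inner x y = (N - 1ℤ) * (⟦ finEq x y ⟧ * d y) - d y
    ring-expand : ∀ N a b e → a * b * (N * e - 1ℤ - e) ≡ a * ((N - 1ℤ) * (e * b) - b)
    ring-expand = solveℤ
    distribute : ∀ a c f → a * (c * a - f) ≡ c * (a * a) - f * a
    distribute = solveℤ
    expand : ∀ x y → d x * d y * coupling y x ≡ d x * inner x y
    expand x y = trans (ring-expand N (d x) (d y) ⟦ finEq y x ⟧)
                       (cong (λ e → d x * ((N - 1ℤ) * (⟦ e ⟧ * d y) - d y)) (finEq-sym y x))
    sum-inner : ∀ x → ∑ colours (inner x) ≡ (N - 1ℤ) * d x - free i j
    sum-inner x = begin
      ∑ colours (inner x)
        ≡⟨ ∑-- colours (λ y → (N - 1ℤ) * (⟦ finEq x y ⟧ * d y)) d ⟩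
      ∑ colours (λ y → (N - 1ℤ) * (⟦ finEq x y ⟧ * d y)) - ∑ colours d
        ≡⟨ cong₂ _-_ (trans (∑-*ˡ colours (N - 1ℤ) (λ y → ⟦ finEq x y ⟧ * d y)) (cong ((N - 1ℤ) *_) (∑-pick x d))) (∑-differs i j) ⟩
      (N - 1ℤ) * d x - free i j ∎

  -- For i = j there are n - 1 admissible colours and the second factor vanishes. For i ≠ j there
  -- are n - 2, the second factor is n - 2, and `coupling i j` = -1 makes the product negative.
  coupling-free : ∀ i j → coupling i j * ((N - 1ℤ) * free i j - free i j * free i j) ≡ - (N - + 2) * (1ℤ - ⟦ finEq i j ⟧)
  coupling-free i j = by-cases N (finEq i j)
    where
    equal : ∀ N → (N * 1ℤ - 1ℤ - 1ℤ) * ((N - 1ℤ) * (N - + 2 + 1ℤ) - (N - + 2 + 1ℤ) * (N - + 2 + 1ℤ)) ≡ - (N - + 2) * (1ℤ - 1ℤ)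
    equal = solveℤ
    distinct : ∀ N → (N * 0ℤ - 1ℤ - 0ℤ) * ((N - 1ℤ) * (N - + 2 + 0ℤ) - (N - + 2 + 0ℤ) * (N - + 2 + 0ℤ)) ≡ - (N - + 2) * (1ℤ - 0ℤ)
    distinct = solveℤ
    by-cases : ∀ N b → (N * ⟦ b ⟧ - 1ℤ - ⟦ b ⟧) * ((N - 1ℤ) * (N - + 2 + ⟦ b ⟧) - (N - + 2 + ⟦ b ⟧) * (N - + 2 + ⟦ b ⟧)) ≡
                       - (N - + 2) * (1ℤ - ⟦ b ⟧)
    by-cases N true  = equal N
    by-cases N false = distinct N

  module _ (τ : ℕ → ℤ) (cyc : Cyclotomic n τ) (τ0 : τ 0 ≡ 1ℤ) where

    term : Fin n → Fin n → Vec (Fin n) m → Fin n → Fin n → Vec (Fin n) m → ℤ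
    term c₀ c₁ xs cₙ k ys = ⟦ properᵇ (saltire n n) (assemble c₀ c₁ xs cₙ k ys) ⟧ * τ (colourSum (assemble c₀ c₁ xs cₙ k ys))

    cross : Fin n → Fin n → Fin n → Fin n → ℤ
    cross c₀ c₁ cₙ k = ⟦ differs c₁ cₙ c₀ ⟧ * ⟦ differs c₁ cₙ k ⟧

    left : Fin n → Vec (Fin n) m → Fin n → ℕ
    left c₁ xs cₙ = toℕ c₁ ℕ.+ (colourSum xs ℕ.+ toℕ cₙ)

    term-split : ∀ c₀ c₁ xs cₙ k ys → term c₀ c₁ xs cₙ k ys ≡
      cross c₀ c₁ cₙ k * ⟦ pathᵇ c₁ xs cₙ ⟧ * (⟦ pathᵇ k ys c₀ ⟧ * τ (left c₁ xs cₙ ℕ.+ left k ys c₀))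
    term-split c₀ c₁ xs cₙ k ys = begin
      term c₀ c₁ xs cₙ k ys
        ≡⟨ cong₂ (λ b s → ⟦ b ⟧ * τ s) (proper≡split c₀ c₁ xs cₙ k ys) (colourSum-assemble c₀ c₁ xs cₙ k ys) ⟩
      ⟦ split-proper c₀ c₁ xs cₙ k ys ⟧ * τ total′
        ≡⟨ cong (_* τ total′) (trans (⟦⟧-∧ (differs c₁ cₙ c₀ ∧ differs c₁ cₙ k) (pathᵇ c₁ xs cₙ ∧ pathᵇ k ys c₀))
             (cong₂ _*_ (⟦⟧-∧ (differs c₁ cₙ c₀) (differs c₁ cₙ k)) (⟦⟧-∧ (pathᵇ c₁ xs cₙ) (pathᵇ k ys c₀)))) ⟩
      cross c₀ c₁ cₙ k * (⟦ pathᵇ c₁ xs cₙ ⟧ * ⟦ pathᵇ k ys c₀ ⟧) * τ total′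
        ≡⟨ regroup (cross c₀ c₁ cₙ k) ⟦ pathᵇ c₁ xs cₙ ⟧ ⟦ pathᵇ k ys c₀ ⟧ (τ total′) ⟩
      cross c₀ c₁ cₙ k * ⟦ pathᵇ c₁ xs cₙ ⟧ * (⟦ pathᵇ k ys c₀ ⟧ * τ total′) ∎
      where
      total′ : ℕ
      total′ = left c₁ xs cₙ ℕ.+ left k ys c₀
      regroup : ∀ a b c d → a * (b * c) * d ≡ a * b * (c * d)
      regroup = solveℤ

    -- While the second path is summed, the exponent of the first one is a fixed translation of τ.
    ∑-term-ys : ∀ c₀ c₁ xs cₙ k → ∑ paths (term c₀ c₁ xs cₙ k) ≡
      cross c₀ c₁ cₙ k * (sign m * coupling k c₀) * (⟦ pathᵇ c₁ xs cₙ ⟧ * τ (left c₁ xs cₙ))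
    ∑-term-ys c₀ c₁ xs cₙ k = begin
      ∑ paths (term c₀ c₁ xs cₙ k)
        ≡⟨ ∑-cong paths (term-split c₀ c₁ xs cₙ k) ⟩
      ∑ paths (λ ys → cross c₀ c₁ cₙ k * ⟦ pathᵇ c₁ xs cₙ ⟧ * (⟦ pathᵇ k ys c₀ ⟧ * τ (left c₁ xs cₙ ℕ.+ left k ys c₀)))
        ≡⟨ ∑-*ˡ paths (cross c₀ c₁ cₙ k * ⟦ pathᵇ c₁ xs cₙ ⟧) (λ ys → ⟦ pathᵇ k ys c₀ ⟧ * τ (left c₁ xs cₙ ℕ.+ left k ys c₀)) ⟩
      cross c₀ c₁ cₙ k * ⟦ pathᵇ c₁ xs cₙ ⟧ * walk m k c₀ (λ s → τ (left c₁ xs cₙ ℕ.+ s))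
        ≡⟨ cong (cross c₀ c₁ cₙ k * ⟦ pathᵇ c₁ xs cₙ ⟧ *_) (trans (walk-coupling k c₀ (cyclotomic-translate cyc (left c₁ xs cₙ)))
             (cong (λ s → sign m * (coupling k c₀ * τ s)) (ℕₚ.+-identityʳ (left c₁ xs cₙ)))) ⟩
      cross c₀ c₁ cₙ k * ⟦ pathᵇ c₁ xs cₙ ⟧ * (sign m * (coupling k c₀ * τ (left c₁ xs cₙ)))
        ≡⟨ regroup (cross c₀ c₁ cₙ k) ⟦ pathᵇ c₁ xs cₙ ⟧ (sign m) (coupling k c₀) (τ (left c₁ xs cₙ)) ⟩
      cross c₀ c₁ cₙ k * (sign m * coupling k c₀) * (⟦ pathᵇ c₁ xs cₙ ⟧ * τ (left c₁ xs cₙ)) ∎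
      where
      regroup : ∀ a p s b t → a * p * (s * (b * t)) ≡ a * (s * b) * (p * t)
      regroup = solveℤ

    -- Both paths have m inner vertices and carry the same sign (-1)ᵐ, so the signs cancel.
    ∑-term-xs : ∀ c₀ c₁ cₙ k → ∑ paths (λ xs → ∑ paths (term c₀ c₁ xs cₙ k)) ≡ coupling c₁ cₙ * (cross c₀ c₁ cₙ k * coupling k c₀)
    ∑-term-xs c₀ c₁ cₙ k = begin
      ∑ paths (λ xs → ∑ paths (term c₀ c₁ xs cₙ k))
        ≡⟨ ∑-cong paths (λ xs → ∑-term-ys c₀ c₁ xs cₙ k) ⟩
      ∑ paths (λ xs → c * (⟦ pathᵇ c₁ xs cₙ ⟧ * τ (left c₁ xs cₙ)))
        ≡⟨ ∑-*ˡ paths c (λ xs → ⟦ pathᵇ c₁ xs cₙ ⟧ * τ (left c₁ xs cₙ)) ⟩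
      c * walk m c₁ cₙ τ
        ≡⟨ cong (c *_) (trans (walk-coupling c₁ cₙ cyc) (cong (λ t → sign m * (coupling c₁ cₙ * t)) τ0)) ⟩
      c * (sign m * (coupling c₁ cₙ * 1ℤ))
        ≡⟨ regroup (cross c₀ c₁ cₙ k) (sign m) (coupling k c₀) (coupling c₁ cₙ) ⟩
      sign m * sign m * (coupling c₁ cₙ * (cross c₀ c₁ cₙ k * coupling k c₀))
        ≡⟨ cong (_* (coupling c₁ cₙ * (cross c₀ c₁ cₙ k * coupling k c₀))) (sign² m) ⟩
      1ℤ * (coupling c₁ cₙ * (cross c₀ c₁ cₙ k * coupling k c₀))
        ≡⟨ ℤₚ.*-identityˡ (coupling c₁ cₙ * (cross c₀ c₁ cₙ k * coupling k c₀)) ⟩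
      coupling c₁ cₙ * (cross c₀ c₁ cₙ k * coupling k c₀) ∎
      where
      c : ℤ
      c = cross c₀ c₁ cₙ k * (sign m * coupling k c₀)
      regroup : ∀ a s b d → a * (s * b) * (s * (d * 1ℤ)) ≡ s * s * (d * (a * b))
      regroup = solveℤ

    ∑-proper-unfold : ∑ (vecs colours (n ℕ.+ n)) (λ κ → ⟦ properᵇ (saltire n n) κ ⟧ * τ (colourSum κ)) ≡
      ∑ colours (λ c₀ → ∑ colours (λ c₁ → ∑ paths (λ xs → ∑ colours (λ cₙ → ∑ colours (λ k → ∑ paths (term c₀ c₁ xs cₙ k))))))
    ∑-proper-unfold =
      trans (∑-vecs colours (suc (m ℕ.+ n)) f) (∑-cong colours λ c₀ →
      trans (∑-vecs colours (m ℕ.+ n) (λ v → f (c₀ ∷ v))) (∑-cong colours λ c₁ →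
      trans (∑-vecs-++ colours m n (λ v → f (c₀ ∷ c₁ ∷ v))) (∑-cong paths λ xs →
      trans (∑-vecs colours (suc m) (λ v → f (c₀ ∷ c₁ ∷ (xs Vec.++ v)))) (∑-cong colours λ cₙ →
      ∑-vecs colours m (λ v → f (c₀ ∷ c₁ ∷ (xs Vec.++ (cₙ ∷ v))))))))
      where
      f : Vec (Fin n) (n ℕ.+ n) → ℤ
      f κ = ⟦ properᵇ (saltire n n) κ ⟧ * τ (colourSum κ)

    ∑-proper : ∑ (vecs colours (n ℕ.+ n)) (λ κ → ⟦ properᵇ (saltire n n) κ ⟧ * τ (colourSum κ)) ≡ N * (- (N - + 2) * (N - 1ℤ))
    ∑-proper = begin
      ∑ (vecs colours (n ℕ.+ n)) (λ κ → ⟦ properᵇ (saltire n n) κ ⟧ * τ (colourSum κ))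
        ≡⟨ ∑-proper-unfold ⟩
      ∑ colours (λ c₀ → ∑ colours (λ c₁ → ∑ paths (λ xs → ∑ colours (λ cₙ → ∑ colours (λ k → ∑ paths (term c₀ c₁ xs cₙ k))))))
        ≡⟨ ∑-cong colours (λ c₀ → ∑-cong colours (λ c₁ → begin
             ∑ paths (λ xs → ∑ colours (λ cₙ → ∑ colours (λ k → ∑ paths (term c₀ c₁ xs cₙ k))))
               ≡⟨ ∑-swap paths colours (λ xs cₙ → ∑ colours (λ k → ∑ paths (term c₀ c₁ xs cₙ k))) ⟩
             ∑ colours (λ cₙ → ∑ paths (λ xs → ∑ colours (λ k → ∑ paths (term c₀ c₁ xs cₙ k))))
               ≡⟨ ∑-cong colours (λ cₙ → trans (∑-swap paths colours (λ xs k → ∑ paths (term c₀ c₁ xs cₙ k)))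
                                               (∑-cong colours (λ k → ∑-term-xs c₀ c₁ cₙ k))) ⟩
             ∑ colours (λ cₙ → ∑ colours (λ k → weighted c₁ cₙ c₀ k)) ∎)) ⟩
      ∑ colours (λ c₀ → ∑ colours (λ c₁ → ∑ colours (λ cₙ → ∑ colours (λ k → weighted c₁ cₙ c₀ k))))
        -- The end colours of the first path move outside; its n (n - 1) ordered pairs of distinct
        -- ends then contribute -(n - 2) each.
        ≡⟨ ∑-swap colours colours (λ c₀ c₁ → ∑ colours (λ cₙ → ∑ colours (λ k → weighted c₁ cₙ c₀ k))) ⟩
      ∑ colours (λ c₁ → ∑ colours (λ c₀ → ∑ colours (λ cₙ → ∑ colours (λ k → weighted c₁ cₙ c₀ k))))
        ≡⟨ ∑-cong colours (λ c₁ → trans (∑-swap colours colours (λ c₀ cₙ → ∑ colours (λ k → weighted c₁ cₙ c₀ k)))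
                                        (∑-cong colours (λ cₙ → sum-weighted c₁ cₙ))) ⟩
      ∑ colours (λ i → ∑ colours (λ j → - (N - + 2) * (1ℤ - ⟦ finEq i j ⟧)))
        ≡⟨ ∑-cong colours (λ i → trans (∑-*ˡ colours (- (N - + 2)) (λ j → 1ℤ - ⟦ finEq i j ⟧))
             (cong ((- (N - + 2)) *_) (trans (∑-- colours (λ _ → 1ℤ) (λ j → ⟦ finEq i j ⟧)) (cong₂ _-_ ∑-one (∑-finEq i))))) ⟩
      ∑ colours (λ _ → - (N - + 2) * (N - 1ℤ))
        ≡⟨ ∑-const n (- (N - + 2) * (N - 1ℤ)) ⟩
      N * (- (N - + 2) * (N - 1ℤ)) ∎
      where
      weighted : Fin n → Fin n → Fin n → Fin n → ℤ
      weighted i j x y = coupling i j * (cross x i j y * coupling y x)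
      sum-weighted : ∀ i j → ∑ colours (λ x → ∑ colours (λ y → weighted i j x y)) ≡ - (N - + 2) * (1ℤ - ⟦ finEq i j ⟧)
      sum-weighted i j = begin
        ∑ colours (λ x → ∑ colours (λ y → weighted i j x y))
          ≡⟨ ∑-cong colours (λ x → ∑-*ˡ colours (coupling i j) (λ y → cross x i j y * coupling y x)) ⟩
        ∑ colours (λ x → coupling i j * ∑ colours (λ y → cross x i j y * coupling y x))
          ≡⟨ ∑-*ˡ colours (coupling i j) (λ x → ∑ colours (λ y → cross x i j y * coupling y x)) ⟩
        coupling i j * ∑ colours (λ x → ∑ colours (λ y → cross x i j y * coupling y x))
          ≡⟨ cong (coupling i j *_) (∑-coupling i j) ⟩
        coupling i j * ((N - 1ℤ) * free i j - free i j * free i j)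
          ≡⟨ coupling-free i j ⟩
        - (N - + 2) * (1ℤ - ⟦ finEq i j ⟧) ∎

-- Linear functionals and e-positivity

ι : ℤ → ℚ
ι z = z ℚ./ 1

-- The fraction `z / 1` is reduced by a gcd that does not compute for a variable `z`, so arithmetic
-- is carried out on unnormalised fractions.
toℚᵘ-ι : ∀ z → ℚ.toℚᵘ (ι z) ℚᵘ.≃ ℚᵘ.mkℚᵘ z 0
toℚᵘ-ι z = ℚₚ.toℚᵘ-fromℚᵘ (ℚᵘ.mkℚᵘ z 0)

ι-+ : ∀ x y → ι (x + y) ≡ ι x ℚ.+ ι y
ι-+ x y = ℚₚ.toℚᵘ-injective (ℚᵘₚ.≃-trans (toℚᵘ-ι (x + y)) (ℚᵘₚ.≃-trans
  (ℚᵘ.*≡* (cong (_* + 1) (sym (cong₂ _+_ (ℤₚ.*-identityʳ x) (ℤₚ.*-identityʳ y)))))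
  (ℚᵘₚ.≃-sym (ℚᵘₚ.≃-trans (ℚₚ.toℚᵘ-homo-+ (ι x) (ι y)) (ℚᵘₚ.+-cong (toℚᵘ-ι x) (toℚᵘ-ι y))))))

ι-* : ∀ x y → ι (x * y) ≡ ι x ℚ.* ι y
ι-* x y = ℚₚ.toℚᵘ-injective (ℚᵘₚ.≃-trans (toℚᵘ-ι (x * y)) (ℚᵘₚ.≃-trans
  (ℚᵘ.*≡* refl)
  (ℚᵘₚ.≃-sym (ℚᵘₚ.≃-trans (ℚₚ.toℚᵘ-homo-* (ι x) (ι y)) (ℚᵘₚ.*-cong (toℚᵘ-ι x) (toℚᵘ-ι y))))))

ι-nonneg : ∀ {z} → 0ℤ ℤ.≤ z → 0ℚ ℚ.≤ ι z
ι-nonneg {z} 0≤z = ℚₚ.toℚᵘ-cancel-≤ (ℚᵘₚ.≤-respʳ-≃ (ℚᵘₚ.≃-sym (toℚᵘ-ι z)) (ℚᵘ.*≤* (ℤₚ.*-monoʳ-≤-nonNeg (+ 1) 0≤z)))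

ι-reflects-nonneg : ∀ {z} → 0ℚ ℚ.≤ ι z → 0ℤ ℤ.≤ z
ι-reflects-nonneg {z} 0≤ιz with ℚᵘ.*≤* p ← ℚᵘₚ.≤-respʳ-≃ (toℚᵘ-ι z) (ℚₚ.toℚᵘ-mono-≤ 0≤ιz) =
  ℤₚ.*-cancelʳ-≤-pos 0ℤ z (+ 1) p

ι-∑ : ∀ {A : Set} (xs : List A) f → ι (∑ xs f) ≡ Sumℚ.∑ xs (λ x → ι (f x))
ι-∑ []       f = refl
ι-∑ (x ∷ xs) f = trans (ι-+ (f x) (∑ xs f)) (cong (ι (f x) ℚ.+_) (ι-∑ xs f))

*-nonneg : ∀ {p q} → 0ℚ ℚ.≤ p → 0ℚ ℚ.≤ q → 0ℚ ℚ.≤ p ℚ.* q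
*-nonneg {p} {q} 0≤p 0≤q = subst (ℚ._≤ p ℚ.* q) (ℚₚ.*-zeroʳ p) (ℚₚ.*-monoˡ-≤-nonNeg p {{ℚ.nonNegative 0≤p}} 0≤q)

+-nonneg : ∀ {p q} → 0ℚ ℚ.≤ p → 0ℚ ℚ.≤ q → 0ℚ ℚ.≤ p ℚ.+ q
+-nonneg 0≤p 0≤q = ℚₚ.+-mono-≤ 0≤p 0≤q

module _ {N k : ℕ} (A : List (Vec ℕ k)) (τ : Vec ℕ k → ℤ)
  (e-nonneg : ∀ ps → IsPartition N ps → 0ℤ ℤ.≤ ∑ A (λ α → τ α * + coeffE ps α)) where

  terms-nonneg : ∀ (terms : List (ℚ × List ℕ)) → All (λ t → 0ℚ ℚ.≤ proj₁ t × IsPartition N (proj₂ t)) terms →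
    0ℚ ℚ.≤ Sumℚ.∑ A (λ α → ι (τ α) ℚ.* sumℚ (map (λ t → proj₁ t ℚ.* ℕtoℚ (coeffE (proj₂ t) α)) terms))
  terms-nonneg [] [] = ℚₚ.≤-reflexive (sym (Sumℚ.∑-zero A (λ α → ℚₚ.*-zeroʳ (ι (τ α)))))
  terms-nonneg ((q , ps) ∷ terms) ((0≤q , part) ∷ all) = subst (0ℚ ℚ.≤_) (sym split)
    (+-nonneg (*-nonneg 0≤q (ι-nonneg (e-nonneg ps part))) (terms-nonneg terms all))
    where
    rest : Vec ℕ k → ℚ
    rest α = sumℚ (map (λ t → proj₁ t ℚ.* ℕtoℚ (coeffE (proj₂ t) α)) terms)
    term : ∀ α → ι (τ α) ℚ.* (q ℚ.* ℕtoℚ (coeffE ps α)) ≡ q ℚ.* ι (τ α * + coeffE ps α)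
    term α = begin
      ι (τ α) ℚ.* (q ℚ.* ℕtoℚ (coeffE ps α))   ≡⟨ ℚₚ.*-assoc (ι (τ α)) q _ ⟨
      ι (τ α) ℚ.* q ℚ.* ℕtoℚ (coeffE ps α)     ≡⟨ cong (ℚ._* ℕtoℚ (coeffE ps α)) (ℚₚ.*-comm (ι (τ α)) q) ⟩
      q ℚ.* ι (τ α) ℚ.* ℕtoℚ (coeffE ps α)     ≡⟨ ℚₚ.*-assoc q (ι (τ α)) _ ⟩
      q ℚ.* (ι (τ α) ℚ.* ℕtoℚ (coeffE ps α))   ≡⟨ cong (q ℚ.*_) (ι-* (τ α) (+ coeffE ps α)) ⟨
      q ℚ.* ι (τ α * + coeffE ps α)          ∎
    split : Sumℚ.∑ A (λ α → ι (τ α) ℚ.* (q ℚ.* ℕtoℚ (coeffE ps α) ℚ.+ rest α)) ≡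
            q ℚ.* ι (∑ A (λ α → τ α * + coeffE ps α)) ℚ.+ Sumℚ.∑ A (λ α → ι (τ α) ℚ.* rest α)
    split = begin
      Sumℚ.∑ A (λ α → ι (τ α) ℚ.* (q ℚ.* ℕtoℚ (coeffE ps α) ℚ.+ rest α))
        ≡⟨ Sumℚ.∑-cong A (λ α → trans (ℚₚ.*-distribˡ-+ (ι (τ α)) _ (rest α)) (cong (ℚ._+ ι (τ α) ℚ.* rest α) (term α))) ⟩
      Sumℚ.∑ A (λ α → q ℚ.* ι (τ α * + coeffE ps α) ℚ.+ ι (τ α) ℚ.* rest α)
        ≡⟨ Sumℚ.∑-+ A _ _ ⟩
      Sumℚ.∑ A (λ α → q ℚ.* ι (τ α * + coeffE ps α)) ℚ.+ Sumℚ.∑ A (λ α → ι (τ α) ℚ.* rest α)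
        ≡⟨ cong (ℚ._+ Sumℚ.∑ A (λ α → ι (τ α) ℚ.* rest α)) (trans (Sumℚ.∑-*ˡ A q _) (cong (q ℚ.*_) (sym (ι-∑ A _)))) ⟩
      q ℚ.* ι (∑ A (λ α → τ α * + coeffE ps α)) ℚ.+ Sumℚ.∑ A (λ α → ι (τ α) ℚ.* rest α) ∎

  -- A linear functional that is non-negative on every e_λ of degree `N` is non-negative on their
  -- non-negative combinations; a negative value therefore refutes e-positivity.
  EPositive⇒nonneg : ∀ (G : Graph N) → EPositive G → 0ℤ ℤ.≤ ∑ A (λ α → τ α * + coeffX G α)
  EPositive⇒nonneg G (terms , all , expansion) = ι-reflects-nonneg (subst (0ℚ ℚ.≤_) (sym (begin
    ι (∑ A (λ α → τ α * + coeffX G α))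
      ≡⟨ ι-∑ A _ ⟩
    Sumℚ.∑ A (λ α → ι (τ α * + coeffX G α))
      ≡⟨ Sumℚ.∑-cong A (λ α → trans (ι-* (τ α) (+ coeffX G α)) (cong (ι (τ α) ℚ.*_) (expansion k α))) ⟩
    Sumℚ.∑ A (λ α → ι (τ α) ℚ.* sumℚ (map (λ t → proj₁ t ℚ.* ℕtoℚ (coeffE (proj₂ t) α)) terms)) ∎))
    (terms-nonneg terms all))

length≤sum : ∀ ps → All (1 ≤_) ps → length ps ≤ sum ps
length≤sum []       []           = z≤n
length≤sum (p ∷ ps) (0<p ∷ 0<ps) = ℕₚ.+-mono-≤ 0<p (length≤sum ps 0<ps)

-- The hypothesis n ≥ 3 enters here, since for n = 2 the factor n - 2 is 0. Written with n = 3 + m,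
-- the product computes to a negative constructor form.
value-negative : ∀ m → ¬ (0ℤ ℤ.≤ + (3 ℕ.+ m) * (- (+ (3 ℕ.+ m) - + 2) * (+ (3 ℕ.+ m) - 1ℤ)))
value-negative m ()

module Refutation (m : ℕ) (τ : ℕ → ℤ) (cyc : Cyclotomic (3 ℕ.+ m) τ) (τ0 : τ 0 ≡ 1ℤ) where
  n B : ℕ
  n = 3 ℕ.+ m
  -- In degree 2n neither a colour class nor the number of parts exceeds 2n.
  B = suc (n ℕ.+ n)
  open Elementary n (s≤s z≤n)

  e-nonneg : ∀ ps → IsPartition (n ℕ.+ n) ps → 0ℤ ℤ.≤ ∑ (box B n) (λ α → τ (weight α) * + coeffE ps α)
  e-nonneg ps (size , positive , _) =
    subst (0ℤ ℤ.≤_) (sym (∑-coeffE B ps τ (s≤s (subst (length ps ≤_) size (length≤sum ps positive)))))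
          (ev-nonneg cyc τ0 ps size positive)

  value : ∑ (box B n) (λ α → τ (weight α) * + coeffX (saltire n n) α) ≡ + n * (- (+ n - + 2) * (+ n - 1ℤ))
  -- The argument of `Evaluation` is the number of inner vertices of each path, n - 2.
  value = trans (∑-coeffX n (saltire n n) B τ ℕₚ.≤-refl) (Evaluation.∑-proper (suc m) τ cyc τ0)

  not-EPositive : ¬ EPositive (saltire n n)
  not-EPositive epos = value-negative m
    (subst (0ℤ ℤ.≤_) value (EPositive⇒nonneg {n ℕ.+ n} {n} (box B n) (λ α → τ (weight α)) e-nonneg (saltire n n) epos))

saltire-not-EPositive : ∀ m → ¬ EPositive (saltire (3 ℕ.+ m) (3 ℕ.+ m))
saltire-not-EPositive m = let τ , cyc , τ0 = cyclotomic (3 ℕ.+ m) (s≤s z≤n) in Refutation.not-EPositive m τ cyc τ0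

theorem3p5 : (n : ℕ) → 3 ≤ n → ClawContractibleFree (saltire n n) × ¬ EPositive (saltire n n)
theorem3p5 n@(suc (suc (suc m))) (s≤s (s≤s (s≤s z≤n))) =
  saltire-clawContractibleFree n (s≤s (s≤s z≤n)) , saltire-not-EPositive m
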